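{- Let $N>3$ be odd and let $q>8$ be a power of $2$. Then $$t_2(N,q)\le 2q^{\frac{N-1}{2}}+(t_2(2,q)+3)\, q^{\frac{N-3}{2}}+3\sum_{j=1}^{(N-5)/2}q^{j}-N+4,$$ where empty sums are $0$.
   Context: A cap in $PG(N,q)$ is a set of points no three collinear; it is complete if not contained in a larger cap; an arc is a cap in $PG(2,q)$. $t_2(N,q)$ denotes the smallest size of a complete cap in $PG(N,q)$. The sum $3\sum_{j=1}^{(N-5)/2}q^j$ is the paper's $3(q^{\frac{N-5}{2}}+q^{\frac{N-7}{2}}+\dots+q)$. -}

module Defs where

open import Data.Nat using (ℕ; zero; suc; _+_; _*_; _∸_; _^_; _/_; _<_)
open import Data.Fin using (Fin)
open import Data.List using (List; _∷_; length; lookup)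
open import Data.Product using (Σ; ∃; _×_; _,_)
open import Relation.Binary.PropositionalEquality using (_≡_)
open import Relation.Nullary using (¬_)
open import Algebra.Structures using (IsCommutativeRing)

-- A field whose carrier is Fin q (every finite field of order q is
-- isomorphic to one of these; GF(q) is unique up to isomorphism).
record FieldOn (q : ℕ) : Set where
  field
    _⊕_ _⊗_ : Fin q → Fin q → Fin q
    ⊝_      : Fin q → Fin q
    0# 1#   : Fin q
    isCommutativeRing : IsCommutativeRing _≡_ _⊕_ _⊗_ ⊝_ 0# 1#
    0≢1     : ¬ (0# ≡ 1#)
    inverse : ∀ x → ¬ (x ≡ 0#) → ∃ λ y → x ⊗ y ≡ 1#

module _ {q : ℕ} (F : FieldOn q) where
  open FieldOn F

  -- vectors of F^(n+1): homogeneous coordinates for PG(n,q)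
  Vect : ℕ → Set
  Vect n = Fin (suc n) → Fin q

  NonZero : ∀ {n} → Vect n → Set
  NonZero u = ¬ (∀ i → u i ≡ 0#)

  SamePoint : ∀ {n} → Vect n → Vect n → Set
  SamePoint u v = ∃ λ c → ∀ i → v i ≡ c ⊗ u i

  Collinear : ∀ {n} → Vect n → Vect n → Vect n → Set
  Collinear u v w = ∃ λ a → ∃ λ b → ∃ λ c →
    ¬ (a ≡ 0# × b ≡ 0# × c ≡ 0#) ×
    (∀ i → ((a ⊗ u i) ⊕ (b ⊗ v i)) ⊕ (c ⊗ w i) ≡ 0#)

  IsCap : ∀ {n} → List (Vect n) → Set
  IsCap L =
    (∀ i → NonZero (lookup L i)) ×
    (∀ i j → ¬ (i ≡ j) → ¬ SamePoint (lookup L i) (lookup L j)) ×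
    (∀ i j k → ¬ (i ≡ j) → ¬ (i ≡ k) → ¬ (j ≡ k) →
       ¬ Collinear (lookup L i) (lookup L j) (lookup L k))

  IsCompleteCap : ∀ {n} → List (Vect n) → Set
  IsCompleteCap {n} L = IsCap L × (∀ (x : Vect n) → ¬ IsCap (x ∷ L))

  IsT2 : ℕ → ℕ → Set
  IsT2 n k =
    (∃ λ (L : List (Vect n)) → IsCompleteCap L × length L ≡ k) ×
    (∀ (L : List (Vect n)) → IsCompleteCap L → k Data.Nat.≤ length L)

sumPow : ℕ → ℕ → ℕ
sumPow q zero    = 0
sumPow q (suc m) = sumPow q m + q ^ suc m

{-# OPTIONS --safe #-}
module Submission where

-- Write κ(x) = (x₁ , x₁² , … , xₙ , xₙ²).  In characteristic 2 the set K of all κ(x) is a cap of AG(2n,q)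
-- closed under addition, and for α, β, α + β ≠ 0 every vector has the form α κ(x) + β κ(y).  So K lifts
-- secants: if a point lies on a secant of a set of representatives A with α + β ≠ 0, then all points
-- above it lie on secants of A × K.  Moreover the only points at infinity on secants of K are the
-- multiples of the κ(δ), and λ κ(δ) = κ(y) ≠ 0 forces λ = 1.
--
-- * Tower: in PG(2n−1,q) there is a cap of 3(qⁿ⁻¹ + … + q) + 2 − 2(n−1) points, none a direction of K,
--   that covers every point which is not a direction of K.  It is built from (1,p,κ(x)) and
--   (1,p+1,κ(x)) with x ≠ 0, a shifted copy (0,1,κ′(x)), and the previous tower.
-- * If t ≥ q, two full copies of K over 0 and η, one copy without its origin and a tower are complete.
-- * If t < q, some line misses the minimal complete arc, which therefore becomes a set A of t affine
--   points.  Two copies of K cover the affine part; in the hyperplane at infinity A × K covers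
--   everything off the external line, and above that line we take copies of K without origin over
--   X = (1,0), Z = (1,η), Y = (0,1), together with a tower.  Each removed origin lies on a secant of A
--   because the arc is complete.  The coordinates are chosen so that X, Y, Z are not of the form
--   P + P′ with P, P′ ∈ A; counting pairs of A with a given direction shows that this is possible
--   for q > 8.

open import Defs
open import Algebra.Bundles using (CommutativeRing; RawRing)
import Algebra.Solver.Ring as RingSolver
open import Algebra.Solver.Ring.AlmostCommutativeRing
  using (fromCommutativeRing; Induced-equivalence; _-Raw-AlmostCommutative⟶_)
open import Data.Bool using (Bool; true; false; _∧_; _xor_)
open import Data.Empty using (⊥; ⊥-elim)
open import Data.Fin using (Fin; zero; suc; splitAt; join)
open import Data.Fin.Permutation using (Permutation; permutation)
open import Data.Fin.Properties
  using (_≟_; any?; all?; injective⇒≤; suc-injective; splitAt-join; join-splitAt)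
open import Data.List as List using (List; length; _++_; deduplicate; filter)
open import Data.List.Membership.Propositional using (_∈_)
open import Data.List.Membership.Propositional.Properties
  using (∈-map⁺; ∈-map⁻; ∈-++⁺ˡ; ∈-++⁺ʳ; ∈-++⁻; ∈-filter⁺; ∈-filter⁻; ∈-lookup; ∈-deduplicate⁺; ∈-deduplicate⁻)
import Data.List.Properties as List
import Data.List.Relation.Unary.All as All
open import Data.List.Relation.Unary.AllPairs using (_∷_)
import Data.List.Relation.Unary.Any as Any
open import Data.List.Relation.Unary.Any using (here; there)
open import Data.List.Relation.Unary.Any.Properties using (lookup-index)
import Data.List.Relation.Unary.Unique.DecPropositional.Properties as UniqueDec
open import Data.List.Relation.Unary.Unique.Propositional using (Unique)
open import Data.Maybe using (just; nothing)
open import Data.Nat as ℕ using (ℕ; zero; suc; _≤_; _<_; s≤s; z≤n)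
import Data.Nat.Properties as ℕₚ
open import Data.Product using (∃; ∃₂; _×_; _,_; proj₁; proj₂)
open import Data.Sum using (_⊎_; inj₁; inj₂)
open import Data.Sum.Properties using (inj₁-injective; inj₂-injective)
open import Data.Unit using (⊤; tt)
open import Data.Vec as Vec using (Vec; []; _∷_; map; zipWith; replicate; lookup)
import Data.Vec.Properties as Vec
open import Data.Vec.Properties using (∷-injectiveˡ; ∷-injectiveʳ; ≡-dec)
open import Function using (_∘_; id)
open import Function.Definitions using (Injective)
open import Relation.Binary.Definitions using (WeaklyDecidable)
open import Relation.Binary.PropositionalEquality
open import Relation.Nullary using (¬_; Dec; yes; no; contradiction)
open import Relation.Nullary.Decidable using (¬?; _×-dec_; decidable-stable)

-- Counting in finite sets.

missing-value : ∀ {m n} → m < n → (f : Fin m → Fin n) → ∃ λ y → ∀ i → f i ≢ y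
missing-value {m} {n} m<n f with any? (λ y → all? (λ i → ¬? (f i ≟ y)))
... | yes found = found
... | no  none  = contradiction (injective⇒≤ section-injective) (ℕₚ.<⇒≱ m<n)
  where
  section : ∀ y → ∃ λ i → f i ≡ y
  section y with any? (λ i → f i ≟ y)
  ... | yes hit  = hit
  ... | no  miss = ⊥-elim (none (y , λ i e → miss (i , e)))
  section-injective : Injective _≡_ _≡_ (proj₁ ∘ section)
  section-injective {y} {z} e =
    trans (sym (proj₂ (section y))) (trans (cong f e) (proj₂ (section z)))

-- A value missed by `f` could be prepended to it, giving an injection of `suc n` elements into `n`.
injective⇒surjective : ∀ {n} {f : Fin n → Fin n} → Injective _≡_ _≡_ f → ∀ y → ∃ λ x → f x ≡ y
injective⇒surjective {n} {f} inj y with any? (λ x → f x ≟ y)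
... | yes hit  = hit
... | no  miss = contradiction (injective⇒≤ {f = g} g-injective) ℕₚ.1+n≰n
  where
  g : Fin (suc n) → Fin n
  g zero    = y
  g (suc x) = f x
  g-injective : Injective _≡_ _≡_ g
  g-injective {zero}  {zero}  e = refl
  g-injective {zero}  {suc x} e = ⊥-elim (miss (x , sym e))
  g-injective {suc x} {zero}  e = ⊥-elim (miss (x , e))
  g-injective {suc x} {suc z} e = cong suc (inj e)

-- Each ν outside the image of sp uses up two elements of Fin t, hence the doubling.
pairing-bound : ∀ {q r t} (sp : Fin r → Fin q) (_~[_]_ : Fin t → Fin q → Fin t → Set) →
  (∀ {ν i j} → i ~[ ν ] j → j ~[ ν ] i) →
  (∀ {ν ν′ i j j′} → i ~[ ν ] j → i ~[ ν′ ] j′ → ν ≡ ν′) →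
  (∀ ν → (∃ λ k → sp k ≡ ν) ⊎ (∃₂ λ i j → i ≢ j × i ~[ ν ] j)) →
  q ℕ.+ q ≤ (r ℕ.+ r) ℕ.+ t
pairing-bound {q} {r} {t} sp _~[_]_ symm det choose = injective⇒≤ {f = f} f-injective
  where
  Code : Set
  Code = (Fin r ⊎ Fin r) ⊎ Fin t

  g₁ g₂ : Fin q → Code
  g₁ ν with choose ν
  ... | inj₁ (k , _)     = inj₁ (inj₁ k)
  ... | inj₂ (i , _ , _) = inj₂ i
  g₂ ν with choose ν
  ... | inj₁ (k , _)     = inj₁ (inj₂ k)
  ... | inj₂ (_ , j , _) = inj₂ j

  g : Fin q ⊎ Fin q → Code
  g (inj₁ ν) = g₁ ν
  g (inj₂ ν) = g₂ ν

  g₁-injective : ∀ ν ν′ → g₁ ν ≡ g₁ ν′ → ν ≡ ν′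
  g₁-injective ν ν′ e with choose ν | choose ν′
  g₁-injective ν ν′ refl | inj₁ (k , p) | inj₁ (.k , p′) = trans (sym p) p′
  g₁-injective ν ν′ refl | inj₂ (i , j , _ , p) | inj₂ (.i , j′ , _ , p′) = det p p′

  g₂-injective : ∀ ν ν′ → g₂ ν ≡ g₂ ν′ → ν ≡ ν′
  g₂-injective ν ν′ e with choose ν | choose ν′
  g₂-injective ν ν′ refl | inj₁ (k , p) | inj₁ (.k , p′) = trans (sym p) p′
  g₂-injective ν ν′ refl | inj₂ (i , j , _ , p) | inj₂ (i′ , .j , _ , p′) = det (symm p) (symm p′)

  -- If i is the first partner for ν and the second one for ν′, then ν = ν′, so i is its own partner.
  g₁≢g₂ : ∀ ν ν′ → g₁ ν ≢ g₂ ν′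
  g₁≢g₂ ν ν′ e with ν ≟ ν′
  g₁≢g₂ ν .ν e | yes refl with choose ν
  g₁≢g₂ ν .ν () | yes refl | inj₁ _
  g₁≢g₂ ν .ν refl | yes refl | inj₂ (i , .i , i≢i , _) = i≢i refl
  g₁≢g₂ ν ν′ e | no ν≢ν′ with choose ν | choose ν′
  g₁≢g₂ ν ν′ () | no ν≢ν′ | inj₁ _ | inj₁ _
  g₁≢g₂ ν ν′ () | no ν≢ν′ | inj₁ _ | inj₂ _
  g₁≢g₂ ν ν′ refl | no ν≢ν′ | inj₂ (i , j , _ , p) | inj₂ (i′ , .i , _ , p′) = ν≢ν′ (det p (symm p′))

  g-injective : ∀ {x y} → g x ≡ g y → x ≡ y
  g-injective {inj₁ _} {inj₁ _} e = cong inj₁ (g₁-injective _ _ e)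
  g-injective {inj₁ _} {inj₂ _} e = ⊥-elim (g₁≢g₂ _ _ e)
  g-injective {inj₂ _} {inj₁ _} e = ⊥-elim (g₁≢g₂ _ _ (sym e))
  g-injective {inj₂ _} {inj₂ _} e = cong inj₂ (g₂-injective _ _ e)

  encode : Code → Fin ((r ℕ.+ r) ℕ.+ t)
  encode (inj₁ x) = join (r ℕ.+ r) t (inj₁ (join r r x))
  encode (inj₂ i) = join (r ℕ.+ r) t (inj₂ i)

  join-injective : ∀ {m n} (x y : Fin m ⊎ Fin n) → join m n x ≡ join m n y → x ≡ y
  join-injective {m} {n} x y e =
    trans (sym (splitAt-join m n x)) (trans (cong (splitAt m) e) (splitAt-join m n y))

  encode-injective : ∀ x y → encode x ≡ encode y → x ≡ y
  encode-injective (inj₁ x) (inj₁ y) e =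
    cong inj₁ (join-injective x y (inj₁-injective (join-injective (inj₁ _) (inj₁ _) e)))
  encode-injective (inj₁ x) (inj₂ y) e with () ← join-injective {r ℕ.+ r} {t} (inj₁ _) (inj₂ _) e
  encode-injective (inj₂ x) (inj₁ y) e with () ← join-injective {r ℕ.+ r} {t} (inj₂ _) (inj₁ _) e
  encode-injective (inj₂ x) (inj₂ y) e =
    cong inj₂ (inj₂-injective (join-injective {r ℕ.+ r} {t} (inj₂ x) (inj₂ y) e))

  f : Fin (q ℕ.+ q) → Fin ((r ℕ.+ r) ℕ.+ t)
  f x = encode (g (splitAt q x))

  f-injective : Injective _≡_ _≡_ f
  f-injective {x} {y} e =
    trans (sym (join-splitAt q q x))
      (trans (cong (join q q) (g-injective {splitAt q x} {splitAt q y} (encode-injective _ _ e))) (join-splitAt q q y))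

-- The characteristic of a field of order a power of 2.

module _ {q : ℕ} (F : FieldOn q) where
  open FieldOn F

  fieldRing : CommutativeRing _ _
  fieldRing = record { isCommutativeRing = isCommutativeRing }

  private
    open CommutativeRing fieldRing
      using (+-commutativeMonoid; semiring; +-assoc; +-comm; +-identityʳ; +-identityˡ; -‿inverseˡ; -‿inverseʳ;
             *-assoc; *-comm; *-identityʳ; *-identityˡ; zeroˡ; zeroʳ)
    open import Algebra.Properties.CommutativeMonoid.Sum +-commutativeMonoid
      using (sum; sum-permute; ∑-distrib-+; sum-replicate)
    open import Algebra.Properties.Semiring.Mult semiring using (×1-homo-*) renaming (_×_ to _·_)

    translation : Permutation q q
    translation = permutation (_⊕ 1#) (_⊕ (⊝ 1#))
      (λ x → trans (+-assoc x (⊝ 1#) 1#)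
        (trans (cong (x ⊕_) (-‿inverseˡ 1#)) (+-identityʳ x)))
      (λ x → trans (+-assoc x 1# (⊝ 1#))
        (trans (cong (x ⊕_) (-‿inverseʳ 1#)) (+-identityʳ x)))

    -- Translating by 1 permutes the field, so Σ x = Σ (x + 1) = Σ x + q · 1.
    order·1≡0 : q · 1# ≡ 0#
    order·1≡0 = begin
      q · 1#                   ≡⟨ +-identityˡ _ ⟨
      0# ⊕ (q · 1#)            ≡⟨ cong (_⊕ (q · 1#)) (-‿inverseˡ s) ⟨
      ((⊝ s) ⊕ s) ⊕ (q · 1#)   ≡⟨ +-assoc _ _ _ ⟩
      (⊝ s) ⊕ (s ⊕ (q · 1#))   ≡⟨ cong ((⊝ s) ⊕_) s≡ ⟨
      (⊝ s) ⊕ s                ≡⟨ -‿inverseˡ s ⟩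
      0#                       ∎
      where
      open ≡-Reasoning
      s = sum {q} id
      s≡ : s ≡ s ⊕ (q · 1#)
      s≡ = trans (sum-permute id translation)
        (trans (∑-distrib-+ id (λ _ → 1#)) (cong (s ⊕_) (sum-replicate q)))

  ⊗-nonzero : ∀ {x y} → x ≢ 0# → y ≢ 0# → x ⊗ y ≢ 0#
  ⊗-nonzero {x} {y} x≢0 y≢0 xy≡0 with inverse x x≢0
  ... | z , xz≡1 = y≢0 (begin
    y            ≡⟨ *-identityˡ y ⟨
    1# ⊗ y       ≡⟨ cong (_⊗ y) (trans (*-comm z x) xz≡1) ⟨
    (z ⊗ x) ⊗ y  ≡⟨ *-assoc z x y ⟩
    z ⊗ (x ⊗ y)  ≡⟨ cong (z ⊗_) xy≡0 ⟩
    z ⊗ 0#       ≡⟨ zeroʳ z ⟩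
    0#           ∎)
    where open ≡-Reasoning

  -- Without zero divisors a nonzero 2 has only nonzero powers, whereas q · 1 vanishes. Decidable
  -- equality removes the double negation.
  characteristic-2 : ∀ e → q ≡ 2 ℕ.^ e → 1# ⊕ 1# ≡ 0#
  characteristic-2 e q≡2^e = decidable-stable (1# ⊕ 1# ≟ 0#) λ 2≢0 →
    2^≢0 2≢0 e (trans (cong (_· 1#) (sym q≡2^e)) order·1≡0)
    where
    2^≢0 : 1# ⊕ 1# ≢ 0# → ∀ e → (2 ℕ.^ e) · 1# ≢ 0#
    2^≢0 2≢0 zero    eq = 0≢1 (sym (trans (sym (+-identityʳ 1#)) eq))
    2^≢0 2≢0 (suc e) eq = ⊗-nonzero
      (λ 2·1≡0 → 2≢0 (trans (cong (1# ⊕_) (sym (+-identityʳ 1#))) 2·1≡0))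
      (2^≢0 2≢0 e) (trans (sym (×1-homo-* 2 (2 ℕ.^ e))) eq)

-- Unlike `n * 2` with the library multiplication followed by lemmas, this reduces to two
-- successors, so that coordinates can be split off in pairs by pattern matching.
dbl : ℕ → ℕ
dbl zero    = zero
dbl (suc n) = suc (suc (dbl n))

-- Algebra in characteristic 2 and the translation cap.

module Char2 {q : ℕ} (F : FieldOn q) (1+1≡0 : FieldOn._⊕_ F (FieldOn.1# F) (FieldOn.1# F) ≡ FieldOn.0# F) where
  open FieldOn F renaming (_⊕_ to infixl 6 _+_; _⊗_ to infixl 7 _*_) public
  open CommutativeRing (fieldRing F) public
    using (+-assoc; +-comm; +-identityʳ; +-identityˡ; *-assoc; *-comm; *-identityʳ; *-identityˡ;
           zeroˡ; zeroʳ; distribˡ; distribʳ; -‿inverseˡ)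

  K : Set
  K = Fin q

  private
    𝔽₂ : RawRing _ _
    𝔽₂ = record
      { Carrier = Bool ; _≈_ = _≡_ ; _+_ = _xor_ ; _*_ = _∧_ ; -_ = λ x → x ; 0# = false ; 1# = true }

    ⟦_⟧ : Bool → K
    ⟦ false ⟧ = 0#
    ⟦ true  ⟧ = 1#

    -1≡1 : ⊝ 1# ≡ 1#
    -1≡1 = begin
      ⊝ 1#                ≡⟨ +-identityʳ _ ⟨
      ⊝ 1# + 0#           ≡⟨ cong (⊝ 1# +_) 1+1≡0 ⟨
      ⊝ 1# + (1# + 1#)    ≡⟨ +-assoc _ _ _ ⟨
      (⊝ 1# + 1#) + 1#    ≡⟨ cong (_+ 1#) (-‿inverseˡ 1#) ⟩
      0# + 1#             ≡⟨ +-identityˡ 1# ⟩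
      1#                  ∎
      where open ≡-Reasoning

    -0≡0 : ⊝ 0# ≡ 0#
    -0≡0 = trans (sym (+-identityʳ _)) (-‿inverseˡ 0#)

    𝔽₂⟶F : 𝔽₂ -Raw-AlmostCommutative⟶ fromCommutativeRing (fieldRing F)
    𝔽₂⟶F = record
      { ⟦_⟧    = ⟦_⟧
      ; +-homo = λ { false y → sym (+-identityˡ _) ; true false → sym (+-identityʳ _) ; true true → sym 1+1≡0 }
      ; *-homo = λ { false y → sym (zeroˡ _) ; true y → sym (*-identityˡ _) }
      ; -‿homo = λ { false → sym -0≡0 ; true → sym -1≡1 }
      ; 0-homo = refl
      ; 1-homo = refl }

    coefficient-≟ : WeaklyDecidable (Induced-equivalence 𝔽₂⟶F)
    coefficient-≟ false false = just refl
    coefficient-≟ true  true  = just refl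
    coefficient-≟ _     _     = nothing

  -- Coefficients in 𝔽₂ let the solver cancel x + x.
  open RingSolver 𝔽₂ (fromCommutativeRing (fieldRing F)) 𝔽₂⟶F
    coefficient-≟ public
    using (Polynomial; con; solve; _:=_; _:+_; _:*_)

  𝟘 𝟙 : ∀ {m} → Polynomial m
  𝟘 = con false
  𝟙 = con true

  1≢0 : 1# ≢ 0#
  1≢0 e = 0≢1 (sym e)

  x+x≡0 : ∀ x → x + x ≡ 0#
  x+x≡0 = solve 1 (λ x → x :+ x := 𝟘) refl

  ≡⇒+≡0 : ∀ {x y} → x ≡ y → x + y ≡ 0#
  ≡⇒+≡0 refl = x+x≡0 _

  +≡0⇒≡ : ∀ {x y} → x + y ≡ 0# → x ≡ y
  +≡0⇒≡ {x} {y} e = trans (solve 2 (λ x y → x := x :+ y :+ y) refl x y) (trans (cong (_+ y) e) (+-identityˡ y))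

  -- To derive l ≡ r from hypotheses lᵢ ≡ rᵢ, exhibit l + r as a combination of the lᵢ + rᵢ.
  combine₁ : ∀ {l r l₁ r₁} c → l₁ ≡ r₁ → l + r ≡ c * (l₁ + r₁) → l ≡ r
  combine₁ c e h = +≡0⇒≡ (trans h (trans (cong (c *_) (≡⇒+≡0 e)) (zeroʳ c)))

  combine₂ : ∀ {l r l₁ r₁ l₂ r₂} c₁ c₂ → l₁ ≡ r₁ → l₂ ≡ r₂ →
    l + r ≡ c₁ * (l₁ + r₁) + c₂ * (l₂ + r₂) → l ≡ r
  combine₂ {l₁ = l₁} {r₁} {l₂} {r₂} c₁ c₂ e₁ e₂ h = combine₁ c₂ e₂ (trans h
    (trans (cong (_+ c₂ * (l₂ + r₂)) (trans (cong (c₁ *_) (≡⇒+≡0 e₁)) (zeroʳ c₁))) (+-identityˡ _)))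

  combine₃ : ∀ {l r l₁ r₁ l₂ r₂ l₃ r₃} c₁ c₂ c₃ → l₁ ≡ r₁ → l₂ ≡ r₂ → l₃ ≡ r₃ →
    l + r ≡ c₁ * (l₁ + r₁) + c₂ * (l₂ + r₂) + c₃ * (l₃ + r₃) → l ≡ r
  combine₃ {l₂ = l₂} {r₂} {l₃} {r₃} c₁ c₂ c₃ e₁ e₂ e₃ h = combine₂ c₂ c₃ e₂ e₃
    (trans h (cong (_+ c₃ * (l₃ + r₃)) (trans
      (cong (_+ c₂ * (l₂ + r₂)) (trans (cong (c₁ *_) (≡⇒+≡0 e₁)) (zeroʳ c₁))) (+-identityˡ _))))

  *-nonzero : ∀ {x y} → x ≢ 0# → y ≢ 0# → x * y ≢ 0#
  *-nonzero = ⊗-nonzero F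

  *≡0⇒≡0 : ∀ {x y} → x ≢ 0# → x * y ≡ 0# → y ≡ 0#
  *≡0⇒≡0 {x} {y} x≢0 e with y ≟ 0#
  ... | yes y≡0 = y≡0
  ... | no  y≢0 = ⊥-elim (*-nonzero x≢0 y≢0 e)

  +-nonzero : ∀ {x y} → x ≢ y → x + y ≢ 0#
  +-nonzero x≢y e = x≢y (+≡0⇒≡ e)

  -- Squaring is additive in characteristic 2: x² + y² = (x + y)².
  square-injective : ∀ {x y} → x * x ≡ y * y → x ≡ y
  square-injective {x} {y} e with x ≟ y
  ... | yes x≡y = x≡y
  ... | no  x≢y = ⊥-elim (*-nonzero (+-nonzero x≢y) (+-nonzero x≢y)
          (combine₁ 1# e (solve 2 (λ x y → (x :+ y) :* (x :+ y) :+ 𝟘 := 𝟙 :* (x :* x :+ y :* y)) refl x y)))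

  square-root : ∀ y → ∃ λ x → x * x ≡ y
  square-root = injective⇒surjective square-injective

  divide : ∀ {a} b → a ≢ 0# → ∃ λ c → a * c ≡ b
  divide {a} b a≢0 with inverse a a≢0
  ... | i , ai≡1 = i * b , trans (sym (*-assoc a i b)) (trans (cong (_* b) ai≡1) (*-identityˡ b))

  scale : ∀ {m} → K → Vec K m → Vec K m
  scale a = map (a *_)

  comb : ∀ {m} → K → Vec K m → K → Vec K m → Vec K m
  comb a u b v = zipWith (λ x y → a * x + b * y) u v

  _+ᵛ_ : ∀ {m} → Vec K m → Vec K m → Vec K m
  _+ᵛ_ = zipWith _+_

  𝟎 : ∀ {m} → Vec K m
  𝟎 = replicate _ 0#

  _≟ᵛ_ : ∀ {m} (u v : Vec K m) → Dec (u ≡ v)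
  _≟ᵛ_ = ≡-dec _≟_

  scale-comb : ∀ {m} e a b (u v : Vec K m) → scale e (comb a u b v) ≡ comb (e * a) u (e * b) v
  scale-comb e a b [] [] = refl
  scale-comb e a b (x ∷ u) (y ∷ v) = cong₂ _∷_
    (solve 5 (λ e a b x y → e :* (a :* x :+ b :* y) := e :* a :* x :+ e :* b :* y) refl e a b x y)
    (scale-comb e a b u v)

  scale-scale : ∀ {m} a b (u : Vec K m) → scale a (scale b u) ≡ scale (a * b) u
  scale-scale a b []      = refl
  scale-scale a b (x ∷ u) = cong₂ _∷_ (sym (*-assoc a b x)) (scale-scale a b u)

  scale-1 : ∀ {m} (u : Vec K m) → scale 1# u ≡ u
  scale-1 []      = refl
  scale-1 (x ∷ u) = cong₂ _∷_ (*-identityˡ x) (scale-1 u)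

  scale-0 : ∀ {m} (u : Vec K m) → scale 0# u ≡ 𝟎
  scale-0 []      = refl
  scale-0 (x ∷ u) = cong₂ _∷_ (zeroˡ x) (scale-0 u)

  scale-𝟎 : ∀ {m} a → scale {m} a 𝟎 ≡ 𝟎
  scale-𝟎 {zero}  a = refl
  scale-𝟎 {suc m} a = cong₂ _∷_ (zeroʳ a) (scale-𝟎 a)

  scale≡𝟎 : ∀ {m a} {u : Vec K m} → a ≢ 0# → scale a u ≡ 𝟎 → u ≡ 𝟎
  scale≡𝟎 {u = []}    a≢0 e = refl
  scale≡𝟎 {u = x ∷ u} a≢0 e = cong₂ _∷_ (*≡0⇒≡0 a≢0 (∷-injectiveˡ e)) (scale≡𝟎 a≢0 (∷-injectiveʳ e))

  scale-injective : ∀ {m a} {u v : Vec K m} → a ≢ 0# → scale a u ≡ scale a v → u ≡ v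
  scale-injective {u = []} {[]} a≢0 e = refl
  scale-injective {a = a} {x ∷ u} {y ∷ v} a≢0 e = cong₂ _∷_
    (+≡0⇒≡ (*≡0⇒≡0 a≢0 (trans (distribˡ a x y) (≡⇒+≡0 (∷-injectiveˡ e)))))
    (scale-injective a≢0 (∷-injectiveʳ e))

  comb-comm : ∀ {m} a b (u v : Vec K m) → comb a u b v ≡ comb b v a u
  comb-comm a b [] [] = refl
  comb-comm a b (x ∷ u) (y ∷ v) = cong₂ _∷_ (+-comm _ _) (comb-comm a b u v)

  comb-same : ∀ {m} a b (u : Vec K m) → comb a u b u ≡ scale (a + b) u
  comb-same a b []      = refl
  comb-same a b (x ∷ u) = cong₂ _∷_ (sym (distribʳ x a b)) (comb-same a b u)

  comb-𝟎ˡ : ∀ {m} a b (v : Vec K m) → comb a 𝟎 b v ≡ scale b v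
  comb-𝟎ˡ a b []      = refl
  comb-𝟎ˡ a b (y ∷ v) = cong₂ _∷_ (trans (cong (_+ b * y) (zeroʳ a)) (+-identityˡ _)) (comb-𝟎ˡ a b v)

  -- Expresses the direction `v` of the line through `u` and `w` as a multiple of their difference,
  -- which in characteristic 2 is their sum.
  comb-solve : ∀ {m} b b⁻¹ {u v w : Vec K m} → b * b⁻¹ ≡ 1# → w ≡ comb 1# u b v → v ≡ comb b⁻¹ u b⁻¹ w
  comb-solve b i {[]} {[]} {[]} e h = refl
  comb-solve b i {x ∷ u} {y ∷ v} {z ∷ w} e h = cong₂ _∷_
    (combine₂ y i e (∷-injectiveˡ h)
      (solve 5 (λ b i x y z → y :+ (i :* x :+ i :* z) := y :* (b :* i :+ 𝟙) :+ i :* (z :+ (𝟙 :* x :+ b :* y))) refl b i x y z))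
    (comb-solve b i e (∷-injectiveʳ h))

  -- The product of `n` affine parabolas.
  κ : ∀ {n} → Vec K n → Vec K (dbl n)
  κ []       = []
  κ (x ∷ xs) = x ∷ x * x ∷ κ xs

  κ-𝟎 : ∀ {n} → κ {n} 𝟎 ≡ 𝟎
  κ-𝟎 {zero}  = refl
  κ-𝟎 {suc n} = cong₂ _∷_ refl (cong₂ _∷_ (zeroˡ 0#) κ-𝟎)

  comb-κ : ∀ {n} a (x y : Vec K n) → comb a (κ x) a (κ y) ≡ scale a (κ (x +ᵛ y))
  comb-κ a [] [] = refl
  comb-κ a (x ∷ xs) (y ∷ ys) = cong₂ _∷_ (sym (distribˡ a x y)) (cong₂ _∷_
    (solve 3 (λ a x y → a :* (x :* x) :+ a :* (y :* y) := a :* ((x :+ y) :* (x :+ y))) refl a x y)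
    (comb-κ a xs ys))

  private
    -- Substituting βy = c + αx into β times the quadratic equation leaves α(α + β)x² = βd + c²,
    -- which is solvable because every element is a square.
    solve-pair : ∀ {α β} → α ≢ 0# → β ≢ 0# → α + β ≢ 0# → ∀ c d →
      ∃₂ λ x y → c ≡ α * x + β * y × d ≡ α * (x * x) + β * (y * y)
    solve-pair {α} {β} α≢0 β≢0 α+β≢0 c d
      with divide (β * d + c * c) (*-nonzero α≢0 α+β≢0)
    ... | s , As≡ with square-root s
    ... | x , refl with divide (c + α * x) β≢0
    ... | y , βy≡ = x , y ,
      combine₁ 1# βy≡
        (solve 4 (λ α βy c x → c :+ (α :* x :+ βy) := 𝟙 :* (βy :+ (c :+ α :* x))) refl α (β * y) c x) ,
      +≡0⇒≡ (*≡0⇒≡0 β≢0 (combine₂ 1# (β * y + (c + α * x)) As≡ βy≡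
        (solve 6 (λ α β c d x y →
          β :* (d :+ (α :* (x :* x) :+ β :* (y :* y))) :+ 𝟘 :=
            𝟙 :* (α :* (α :+ β) :* (x :* x) :+ (β :* d :+ c :* c))
            :+ (β :* y :+ (c :+ α :* x)) :* (β :* y :+ (c :+ α :* x)))
          refl α β c d x y)))

    -- Comparing the square of the first equation with the second gives αβ(x + y)² = 0, because α +
    -- β = 1.
    affine-pair : ∀ {α β x y z} → α ≢ 0# → β ≢ 0# → α + β ≡ 1# →
      z ≡ α * x + β * y → z * z ≡ α * (x * x) + β * (y * y) → x ≡ y
    affine-pair {α} {β} {x} {y} {z} α≢0 β≢0 α+β≡1 e₁ e₂ with x ≟ y
    ... | yes x≡y = x≡y
    ... | no  x≢y = ⊥-elim (*-nonzero (*-nonzero α≢0 β≢0) (*-nonzero (+-nonzero x≢y) (+-nonzero x≢y))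
          (combine₃ (α * (x * x) + β * (y * y)) (z + (α * x + β * y)) 1# α+β≡1 e₁ e₂
            (solve 5 (λ α β x y z → α :* β :* ((x :+ y) :* (x :+ y)) :+ 𝟘 :=
               (α :* (x :* x) :+ β :* (y :* y)) :* (α :+ β :+ 𝟙)
               :+ (z :+ (α :* x :+ β :* y)) :* (z :+ (α :* x :+ β :* y))
               :+ 𝟙 :* (z :* z :+ (α :* (x :* x) :+ β :* (y :* y))))
              refl α β x y z)))

  κ-fibre : ∀ {n α β} → α ≢ 0# → β ≢ 0# → α + β ≢ 0# → (v : Vec K (dbl n)) →
    ∃₂ λ x y → v ≡ comb α (κ x) β (κ y)
  κ-fibre {zero}  _   _   _     []          = [] , [] , refl
  κ-fibre {suc n} α≢0 β≢0 α+β≢0 (c ∷ d ∷ v)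
    with solve-pair α≢0 β≢0 α+β≢0 c d | κ-fibre α≢0 β≢0 α+β≢0 v
  ... | x , y , e₁ , e₂ | xs , ys , e = x ∷ xs , y ∷ ys , cong₂ _∷_ e₁ (cong₂ _∷_ e₂ e)

  κ-affine : ∀ {n α β} {x y z : Vec K n} → α ≢ 0# → β ≢ 0# → α + β ≡ 1# →
    κ z ≡ comb α (κ x) β (κ y) → x ≡ y
  κ-affine {x = []} {[]} {[]} _ _ _ e = refl
  κ-affine {x = x ∷ xs} {y ∷ ys} {z ∷ zs} α≢0 β≢0 α+β≡1 e = cong₂ _∷_
    (affine-pair {z = z} α≢0 β≢0 α+β≡1 (∷-injectiveˡ e) (∷-injectiveˡ (∷-injectiveʳ e)))
    (κ-affine α≢0 β≢0 α+β≡1 (∷-injectiveʳ (∷-injectiveʳ e)))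

  -- At a nonzero coordinate y of the left side, y = ax and y² = ax² give y² = a²x² = ay².
  κ-multiple : ∀ {n a} {x y : Vec K n} → y ≢ 𝟎 → κ y ≡ scale a (κ x) → a ≡ 1#
  κ-multiple {x = []} {[]} y≢𝟎 e = ⊥-elim (y≢𝟎 refl)
  κ-multiple {a = a} {x ∷ xs} {y ∷ ys} y≢𝟎 e with y ≟ 0#
  ... | yes refl = κ-multiple {x = xs} {ys} (λ ys≡𝟎 → y≢𝟎 (cong (0# ∷_) ys≡𝟎)) (∷-injectiveʳ (∷-injectiveʳ e))
  ... | no  y≢0  = +≡0⇒≡ (*≡0⇒≡0 (*-nonzero y≢0 y≢0)
          (combine₂ (y + a * x) a (∷-injectiveˡ e) (∷-injectiveˡ (∷-injectiveʳ e))
            (solve 3 (λ a x y → y :* y :* (a :+ 𝟙) :+ 𝟘 :=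
               (y :+ a :* x) :* (y :+ a :* x) :+ a :* (y :* y :+ a :* (x :* x))) refl a x y)))

-- Caps as predicates, and their construction in layers.

module Caps {q : ℕ} (F : FieldOn q) (1+1≡0 : FieldOn._⊕_ F (FieldOn.1# F) (FieldOn.1# F) ≡ FieldOn.0# F) where
  open Char2 F 1+1≡0

  -- Each projective point has at most one representative in `S`: by `distinct`, proportional
  -- members are equal.
  record Cap {m} (S : Vec K m → Set) : Set where
    field
      nonzero     : ∀ {u} → S u → u ≢ 𝟎
      distinct    : ∀ {u v a} → S u → S v → v ≡ scale a u → u ≡ v
      independent : ∀ {u v w a b} → S u → S v → S w → u ≢ v → a ≢ 0# → b ≢ 0# → w ≢ comb a u b v

  -- Coefficients may vanish and `u` may equal `v`, so the members of `S` themselves count as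
  -- covered.
  Covered : ∀ {m} → (Vec K m → Set) → Vec K m → Set
  Covered S x = ∃₂ λ u v → ∃₂ λ a b → S u × S v × x ≡ comb a u b v

  covered-scale : ∀ {m} {S : Vec K m → Set} c {x} → Covered S x → Covered S (scale c x)
  covered-scale c (u , v , a , b , Su , Sv , refl) = u , v , c * a , c * b , Su , Sv , scale-comb c a b u v

  -- Reduces a property stable under scaling to affine points, with first coordinate 1, and points
  -- at infinity, with first coordinate 0.
  normalise : ∀ {m} (P : Vec K (suc m) → Set) → (∀ c {x} → P x → P (scale c x)) →
    (∀ v → P (1# ∷ v)) → (∀ v → P (0# ∷ v)) → ∀ v → P v
  normalise P P-scale P₁ P₀ (h ∷ v) with h ≟ 0#
  ... | yes refl = P₀ v
  ... | no  h≢0 with inverse h h≢0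
  ... | i , hi≡1 = subst P
    (cong₂ _∷_ (*-identityʳ h) (trans (scale-scale h i v) (trans (cong (λ c → scale c v) hi≡1) (scale-1 v))))
    (P-scale h (P₁ (scale i v)))

  -- The affine points in C₁ together with the points at infinity in C₂.
  data Layer {m} (C₁ C₂ : Vec K m → Set) : Vec K (suc m) → Set where
    affine   : ∀ {u} → C₁ u → Layer C₁ C₂ (1# ∷ u)
    infinite : ∀ {u} → C₂ u → Layer C₁ C₂ (0# ∷ u)

  AffinelyIndependent : ∀ {m} → (Vec K m → Set) → Set
  AffinelyIndependent C = ∀ {u v w a b} → C u → C v → C w → u ≢ v → a ≢ 0# → b ≢ 0# → a + b ≡ 1# →
    w ≢ comb a u b v

  -- The two coefficients agree because the first coordinates, 1 and 1, have to cancel at a point at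
  -- infinity.
  AvoidsDirections : ∀ {m} → (Vec K m → Set) → (Vec K m → Set) → Set
  AvoidsDirections C₁ C₂ = ∀ {u v w a} → C₁ u → C₁ v → u ≢ v → C₂ w → a ≢ 0# → w ≢ comb a u a v

  private
    head11 : ∀ a b → a * 1# + b * 1# ≡ a + b
    head11 a b = cong₂ _+_ (*-identityʳ a) (*-identityʳ b)
    head10 : ∀ a b → a * 1# + b * 0# ≡ a
    head10 = solve 2 (λ a b → a :* 𝟙 :+ b :* 𝟘 := a) refl
    head01 : ∀ a b → a * 0# + b * 1# ≡ b
    head01 = solve 2 (λ a b → a :* 𝟘 :+ b :* 𝟙 := b) refl
    head00 : ∀ a b → a * 0# + b * 0# ≡ 0#
    head00 = solve 2 (λ a b → a :* 𝟘 :+ b :* 𝟘 := 𝟘) refl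

  -- First coordinates sort a dependent triple by its number of affine points: three contradict
  -- `AffinelyIndependent`, two contradict `AvoidsDirections`, one is impossible, and none
  -- contradicts the cap at infinity.
  layer-cap : ∀ {m} {C₁ C₂ : Vec K m → Set} →
    AffinelyIndependent C₁ → AvoidsDirections C₁ C₂ → Cap C₂ → Cap (Layer C₁ C₂)
  layer-cap {m} {C₁} {C₂} indep avoids cap₂ = record
    { nonzero     = λ { (affine _) e → 1≢0 (∷-injectiveˡ e)
                      ; (infinite c) e → nonzero c (∷-injectiveʳ e) }
    ; distinct    = distinct′
    ; independent = independent′ }
    where
    open Cap cap₂
    distinct′ : ∀ {u v a} → Layer C₁ C₂ u → Layer C₁ C₂ v → v ≡ scale a u → u ≡ v
    distinct′ {a = a} (affine {u} _) (affine {v} _) e = cong (1# ∷_) (sym (trans (∷-injectiveʳ e)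
      (trans (cong (λ c → scale c u) (trans (sym (*-identityʳ a)) (sym (∷-injectiveˡ e)))) (scale-1 u))))
    distinct′ {a = a} (affine {u} _) (infinite cv) e = ⊥-elim (nonzero cv (trans (∷-injectiveʳ e)
      (trans (cong (λ c → scale c u) (trans (sym (*-identityʳ a)) (sym (∷-injectiveˡ e)))) (scale-0 u))))
    distinct′ {a = a} (infinite _) (affine _) e = ⊥-elim (1≢0 (trans (∷-injectiveˡ e) (zeroʳ a)))
    distinct′ (infinite cu) (infinite cv) e = cong (0# ∷_) (distinct cu cv (∷-injectiveʳ e))

    mixed : ∀ {u v w b} → C₁ u → C₂ v → C₁ w → b ≢ 0# → w ≢ comb 1# u b v
    mixed {u} {v} {w} {b} cu cv cw b≢0 e with inverse b b≢0
    ... | i , bi≡1 = avoids cu cw u≢w cv i≢0 v≡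
      where
      v≡ : v ≡ comb i u i w
      v≡ = comb-solve b i bi≡1 e
      u≢w : u ≢ w
      u≢w refl = nonzero cv (trans v≡ (trans (comb-same i i u) (trans (cong (λ c → scale c u) (x+x≡0 i)) (scale-0 u))))
      i≢0 : i ≢ 0#
      i≢0 refl = 0≢1 (trans (sym (zeroʳ b)) bi≡1)

    independent′ : ∀ {u v w a b} → Layer C₁ C₂ u → Layer C₁ C₂ v → Layer C₁ C₂ w →
      u ≢ v → a ≢ 0# → b ≢ 0# → w ≢ comb a u b v
    independent′ {a = a} {b} (affine cu) (affine cv) (affine cw) u≢v a≢0 b≢0 e =
      indep cu cv cw (λ { refl → u≢v refl }) a≢0 b≢0 (sym (trans (∷-injectiveˡ e) (head11 a b))) (∷-injectiveʳ e)
    independent′ {a = a} {b} (affine cu) (affine cv) (infinite cw) u≢v a≢0 b≢0 e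
      with +≡0⇒≡ (trans (sym (head11 a b)) (sym (∷-injectiveˡ e)))
    ... | refl = avoids cu cv (λ { refl → u≢v refl }) cw a≢0 (∷-injectiveʳ e)
    independent′ {a = a} {b} (affine cu) (infinite cv) (affine cw) u≢v a≢0 b≢0 e
      with trans (sym (head10 a b)) (sym (∷-injectiveˡ e))
    ... | refl = mixed cu cv cw b≢0 (∷-injectiveʳ e)
    independent′ {a = a} {b} (infinite {u} cu) (affine {v} cv) (affine cw) u≢v a≢0 b≢0 e
      with trans (sym (head01 a b)) (sym (∷-injectiveˡ e))
    ... | refl = mixed cv cu cw a≢0 (trans (∷-injectiveʳ e) (comb-comm a 1# u v))
    independent′ {a = a} {b} (affine cu) (infinite cv) (infinite cw) u≢v a≢0 b≢0 e =
      a≢0 (trans (sym (head10 a b)) (sym (∷-injectiveˡ e)))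
    independent′ {a = a} {b} (infinite cu) (affine cv) (infinite cw) u≢v a≢0 b≢0 e =
      b≢0 (trans (sym (head01 a b)) (sym (∷-injectiveˡ e)))
    independent′ {a = a} {b} (infinite cu) (infinite cv) (affine cw) u≢v a≢0 b≢0 e =
      1≢0 (trans (∷-injectiveˡ e) (head00 a b))
    independent′ (infinite cu) (infinite cv) (infinite cw) u≢v a≢0 b≢0 e =
      independent cu cv cw (λ { refl → u≢v refl }) a≢0 b≢0 (∷-injectiveʳ e)

  module _ {m} {C₁ C₂ : Vec K m → Set} where

    covered-affine : ∀ {u v a b x} → C₁ u → C₁ v → a + b ≡ 1# → x ≡ comb a u b v → Covered (Layer C₁ C₂) (1# ∷ x)
    covered-affine {a = a} {b} cu cv a+b≡1 e =
      _ , _ , a , b , affine cu , affine cv , cong₂ _∷_ (sym (trans (head11 a b) a+b≡1)) e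

    covered-mixed : ∀ {u v b x} → C₁ u → C₂ v → x ≡ comb 1# u b v → Covered (Layer C₁ C₂) (1# ∷ x)
    covered-mixed {b = b} cu cv e =
      _ , _ , 1# , b , affine cu , infinite cv , cong₂ _∷_ (sym (head10 1# b)) e

    covered-direction : ∀ {u v a x} → C₁ u → C₁ v → x ≡ comb a u a v → Covered (Layer C₁ C₂) (0# ∷ x)
    covered-direction {a = a} cu cv e =
      _ , _ , a , a , affine cu , affine cv , cong₂ _∷_ (sym (trans (head11 a a) (x+x≡0 a))) e

    covered-infinite : ∀ {x} → Covered C₂ x → Covered (Layer C₁ C₂) (0# ∷ x)
    covered-infinite (u , v , a , b , cu , cv , e) =
      _ , _ , a , b , infinite cu , infinite cv , cong₂ _∷_ (sym (head00 a b)) e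

  data Image {m n} (f : Vec K n → Vec K m) (R : Vec K n → Set) : Vec K m → Set where
    image : ∀ {x} → R x → Image f R (f x)

  data Pair {n} (p₁ p₂ : K) (R : Vec K n → Set) : Vec K (suc (dbl n)) → Set where
    fst : ∀ {x} → R x → Pair p₁ p₂ R (p₁ ∷ κ x)
    snd : ∀ {x} → R x → Pair p₁ p₂ R (p₂ ∷ κ x)

  -- If `u` and `v` lie in one copy, `κ-affine` identifies them. If they lie in different copies, a
  -- combination with nonzero weights has a first coordinate other than `p₁` and `p₂`.
  pair-independent : ∀ {n p₁ p₂} {R : Vec K n → Set} → p₁ ≢ p₂ → AffinelyIndependent (Pair p₁ p₂ R)
  pair-independent {n} {p₁} {p₂} {R} p₁≢p₂ = indep
    where
    outer : ∀ {a b p r} → p ≢ r → b ≢ 0# → a + b ≡ 1# → p ≢ a * p + b * r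
    outer {a} {b} {p} {r} p≢r b≢0 a+b≡1 e = *-nonzero b≢0 (+-nonzero p≢r)
      (combine₂ p 1# a+b≡1 e (solve 4 (λ a b p r → b :* (p :+ r) :+ 𝟘 :=
        p :* (a :+ b :+ 𝟙) :+ 𝟙 :* (p :+ (a :* p :+ b :* r))) refl a b p r))
    p₂≢p₁ : p₂ ≢ p₁
    p₂≢p₁ e = p₁≢p₂ (sym e)
    outer′ : ∀ {a b p r} → p ≢ r → a ≢ 0# → a + b ≡ 1# → p ≢ a * r + b * p
    outer′ {a} {b} p≢r a≢0 a+b≡1 e = outer p≢r a≢0 (trans (+-comm b a) a+b≡1) (trans e (+-comm _ _))
    indep : AffinelyIndependent (Pair p₁ p₂ R)
    indep (fst _) (fst _) (fst {z} _) u≢v a≢0 b≢0 h e =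
      u≢v (cong (λ x → p₁ ∷ κ x) (κ-affine {z = z} a≢0 b≢0 h (∷-injectiveʳ e)))
    indep (fst _) (fst _) (snd {z} _) u≢v a≢0 b≢0 h e =
      u≢v (cong (λ x → p₁ ∷ κ x) (κ-affine {z = z} a≢0 b≢0 h (∷-injectiveʳ e)))
    indep (snd _) (snd _) (fst {z} _) u≢v a≢0 b≢0 h e =
      u≢v (cong (λ x → p₂ ∷ κ x) (κ-affine {z = z} a≢0 b≢0 h (∷-injectiveʳ e)))
    indep (snd _) (snd _) (snd {z} _) u≢v a≢0 b≢0 h e =
      u≢v (cong (λ x → p₂ ∷ κ x) (κ-affine {z = z} a≢0 b≢0 h (∷-injectiveʳ e)))
    indep (fst _) (snd _) (fst _) u≢v a≢0 b≢0 h e = outer p₁≢p₂ b≢0 h (∷-injectiveˡ e)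
    indep (fst _) (snd _) (snd _) u≢v a≢0 b≢0 h e = outer′ p₂≢p₁ a≢0 h (∷-injectiveˡ e)
    indep (snd _) (fst _) (fst _) u≢v a≢0 b≢0 h e = outer′ p₁≢p₂ a≢0 h (∷-injectiveˡ e)
    indep (snd _) (fst _) (snd _) u≢v a≢0 b≢0 h e = outer p₂≢p₁ b≢0 h (∷-injectiveˡ e)

  -- The points at infinity covered by the translation cap.
  Direction : ∀ {n} → Vec K (dbl n) → Set
  Direction {n} v = ∃₂ λ a (δ : Vec K n) → v ≡ scale a (κ δ)

  direction-scale : ∀ {n} c {v} → Direction {n} v → Direction {n} (scale c v)
  direction-scale c (a , δ , refl) = c * a , δ , scale-scale c a (κ δ)

  NonZeroᵛ Everything : ∀ {n} → Vec K n → Set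
  NonZeroᵛ x = x ≢ 𝟎
  Everything _ = ⊤

  -- The translate of `κ` by (0,1,0,...,0): it has the same differences, but its image is disjoint
  -- from that of `κ`.
  κ′ : ∀ {n} → Vec K (suc n) → Vec K (dbl (suc n))
  κ′ (x ∷ xs) = x ∷ x * x + 1# ∷ κ xs

  κ′≢κ : ∀ {n} {x y : Vec K (suc n)} → κ′ x ≢ κ y
  κ′≢κ {x = x ∷ _} {y ∷ _} e with ∷-injectiveˡ e
  ... | refl = 1≢0 (combine₁ 1# (∷-injectiveˡ (∷-injectiveʳ e))
    (solve 1 (λ x → 𝟙 :+ 𝟘 := 𝟙 :* (x :* x :+ 𝟙 :+ x :* x)) refl x))

  comb-κ′ : ∀ {n} a (x y : Vec K (suc n)) → comb a (κ′ x) a (κ′ y) ≡ scale a (κ (x +ᵛ y))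
  comb-κ′ a (x ∷ xs) (y ∷ ys) = cong₂ _∷_ (sym (distribˡ a x y)) (cong₂ _∷_
    (solve 3 (λ a x y → a :* (x :* x :+ 𝟙) :+ a :* (y :* y :+ 𝟙) := a :* ((x :+ y) :* (x :+ y))) refl a x y)
    (comb-κ a xs ys))

  κ′-affine : ∀ {n α β} {x y z : Vec K (suc n)} → α ≢ 0# → β ≢ 0# → α + β ≡ 1# →
    κ′ z ≡ comb α (κ′ x) β (κ′ y) → x ≡ y
  κ′-affine {α = α} {β} {x = x ∷ xs} {y ∷ ys} {z ∷ zs} α≢0 β≢0 α+β≡1 e =
    κ-affine {z = z ∷ zs} α≢0 β≢0 α+β≡1 (cong₂ _∷_ (∷-injectiveˡ e) (cong₂ _∷_
      (combine₂ 1# 1# α+β≡1 (∷-injectiveˡ (∷-injectiveʳ e))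
        (solve 5 (λ α β s t r → r :+ (α :* s :+ β :* t) :=
          𝟙 :* (α :+ β :+ 𝟙) :+ 𝟙 :* (r :+ 𝟙 :+ (α :* (s :+ 𝟙) :+ β :* (t :+ 𝟙)))) refl α β (x * x) (y * y) (z * z)))
      (∷-injectiveʳ (∷-injectiveʳ e))))

  κ′-fibre : ∀ {n α β} → α ≢ 0# → β ≢ 0# → α + β ≢ 0# → (v : Vec K (dbl (suc n))) →
    ∃₂ λ x y → v ≡ comb α (κ′ x) β (κ′ y)
  -- The shift contributes α + β to the second coordinate of a combination, so it is moved over to
  -- the target vector.
  κ′-fibre {α = α} {β} α≢0 β≢0 α+β≢0 (c ∷ d ∷ v) with κ-fibre α≢0 β≢0 α+β≢0 (c ∷ d + (α + β) ∷ v)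
  ... | x ∷ xs , y ∷ ys , e = x ∷ xs , y ∷ ys , cong₂ _∷_ (∷-injectiveˡ e) (cong₂ _∷_
    (combine₁ 1# (∷-injectiveˡ (∷-injectiveʳ e))
      (solve 5 (λ α β d s t → d :+ (α :* (s :+ 𝟙) :+ β :* (t :+ 𝟙)) :=
        𝟙 :* (d :+ (α :+ β) :+ (α :* s :+ β :* t))) refl α β d (x * x) (y * y)))
    (∷-injectiveʳ (∷-injectiveʳ e)))

  κκ′-fibre : ∀ {n α β} → α ≢ 0# → β ≢ 0# → α + β ≢ 0# → (v : Vec K (dbl (suc n))) →
    ∃₂ λ x y → v ≡ comb α (κ x) β (κ′ y)
  κκ′-fibre {α = α} {β} α≢0 β≢0 α+β≢0 (c ∷ d ∷ v) with κ-fibre α≢0 β≢0 α+β≢0 (c ∷ d + β ∷ v)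
  ... | x ∷ xs , y ∷ ys , e = x ∷ xs , y ∷ ys , cong₂ _∷_ (∷-injectiveˡ e) (cong₂ _∷_
    (combine₁ 1# (∷-injectiveˡ (∷-injectiveʳ e))
      (solve 5 (λ α β d s t → d :+ (α :* s :+ β :* (t :+ 𝟙)) :=
        𝟙 :* (d :+ β :+ (α :* s :+ β :* t))) refl α β d (x * x) (y * y)))
    (∷-injectiveʳ (∷-injectiveʳ e)))

  -- Over the points (1,`p₁`), (1,`p₂`), (0,1) of a projective line stand two copies of `κ` and one
  -- of `f`; `T` lies where the first two coordinates vanish.
  Step : ∀ {n} (f : Vec K n → Vec K (dbl n)) (p₁ p₂ : K) (R R′ : Vec K n → Set) (T : Vec K (dbl n) → Set) →
    Vec K (dbl (suc n)) → Set
  Step f p₁ p₂ R R′ T = Layer (Pair p₁ p₂ R) (Layer (Image f R′) T)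

  record TranslationLike {n} (f : Vec K n → Vec K (dbl n)) : Set where
    field
      difference : ∀ a x y → comb a (f x) a (f y) ≡ scale a (κ (x +ᵛ y))
      no-three   : ∀ {α β x y z} → α ≢ 0# → β ≢ 0# → α + β ≡ 1# → f z ≡ comb α (f x) β (f y) → x ≡ y

  κ-translationLike : ∀ {n} → TranslationLike (κ {n})
  κ-translationLike = record { difference = comb-κ ; no-three = κ-affine }

  κ′-translationLike : ∀ {n} → TranslationLike (κ′ {n})
  κ′-translationLike = record { difference = comb-κ′ ; no-three = κ′-affine }

  -- Differences inside one family are multiples of some `κ δ`, which `T` avoids. The critical
  -- triples take one point from each family; their second coordinates force a(p₁ + p₂) = 1, and
  -- `clash` excludes them.
  step-cap : ∀ {n} {f : Vec K n → Vec K (dbl n)} {p₁ p₂ R R′} {T : Vec K (dbl n) → Set} →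
    TranslationLike f → p₁ ≢ p₂ →
    (∀ {a δ y} → a * (p₁ + p₂) ≡ 1# → R′ y → f y ≢ scale a (κ δ)) →
    Cap T → (∀ {v} → T v → ¬ Direction v) → Cap (Step f p₁ p₂ R R′ T)
  step-cap {n} {f} {p₁} {p₂} {R} {R′} {T} tl p₁≢p₂ clash T-cap T-avoids =
    layer-cap (pair-independent p₁≢p₂) avoids₁ (layer-cap indep₂ avoids₂ T-cap)
    where
    open TranslationLike tl
    indep₂ : AffinelyIndependent (Image f R′)
    indep₂ (image _) (image _) (image _) u≢v a≢0 b≢0 h e = u≢v (cong f (no-three a≢0 b≢0 h e))
    avoids₂ : AvoidsDirections (Image f R′) T
    avoids₂ {a = a} (image {x} _) (image {y} _) _ Tw _ e = T-avoids Tw (a , _ , trans e (difference a x y))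

    parallel : ∀ {p w a} {x y : Vec K n} → Layer (Image f R′) T w → w ≢ comb a (p ∷ κ x) a (p ∷ κ y)
    parallel {p} {a = a} (affine _) e = 1≢0 (trans (∷-injectiveˡ e) (x+x≡0 (a * p)))
    parallel {a = a} {x} {y} (infinite Tw) e = T-avoids Tw (a , _ , trans (∷-injectiveʳ e) (comb-κ a x y))

    transversal : ∀ {w a} {x y : Vec K n} → a ≢ 0# → Layer (Image f R′) T w → w ≢ comb a (p₁ ∷ κ x) a (p₂ ∷ κ y)
    transversal {a = a} {x} {y} a≢0 (affine (image Ry)) e =
      clash (trans (distribˡ a p₁ p₂) (sym (∷-injectiveˡ e))) Ry (trans (∷-injectiveʳ e) (comb-κ a x y))
    transversal {a = a} a≢0 (infinite _) e =
      *-nonzero a≢0 (+-nonzero p₁≢p₂) (trans (distribˡ a p₁ p₂) (sym (∷-injectiveˡ e)))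

    avoids₁ : AvoidsDirections (Pair p₁ p₂ R) (Layer (Image f R′) T)
    avoids₁ (fst _) (fst _) _ w _ e = parallel w e
    avoids₁ (snd _) (snd _) _ w _ e = parallel w e
    avoids₁ (fst _) (snd _) _ w a≢0 e = transversal a≢0 w e
    avoids₁ {u} {v} {a = a} (snd _) (fst _) _ w a≢0 e = transversal a≢0 w (trans e (comb-comm a a u v))

-- Secants that avoid removed origins.

module Coverage {q : ℕ} (F : FieldOn q) (1+1≡0 : FieldOn._⊕_ F (FieldOn.1# F) (FieldOn.1# F) ≡ FieldOn.0# F) (4<q : 4 < q) where
  open Char2 F 1+1≡0
  open Caps F 1+1≡0

  avoid-four : ∀ a b c d → ∃ λ x → x ≢ a × x ≢ b × x ≢ c × x ≢ d
  avoid-four a b c d with missing-value 4<q (lookup (a ∷ b ∷ c ∷ d ∷ []))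
  ... | x , miss = x , (λ e → miss zero (sym e)) , (λ e → miss (suc zero) (sym e)) ,
    (λ e → miss (suc (suc zero)) (sym e)) , (λ e → miss (suc (suc (suc zero))) (sym e))

  κ-ratio : ∀ {n γ β} {z y : Vec K n} → γ ≢ 0# → z ≢ 𝟎 → scale γ (κ z) ≡ scale β (κ y) → γ ≡ β
  κ-ratio {γ = γ} {β} {z} {y} γ≢0 z≢𝟎 e with inverse γ γ≢0
  ... | i , γi≡1 = combine₂ β γ γi≡1 (κ-multiple {x = y} z≢𝟎 κz≡)
      (solve 3 (λ γ β i → γ :+ β := β :* (γ :* i :+ 𝟙) :+ γ :* (i :* β :+ 𝟙)) refl γ β i)
    where
    κz≡ : κ z ≡ scale (i * β) (κ y)
    κz≡ = begin
      κ z                    ≡⟨ scale-1 (κ z) ⟨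
      scale 1# (κ z)         ≡⟨ cong (λ c → scale c (κ z)) (trans (*-comm i γ) γi≡1) ⟨
      scale (i * γ) (κ z)    ≡⟨ scale-scale i γ (κ z) ⟨
      scale i (scale γ (κ z)) ≡⟨ cong (scale i) e ⟩
      scale i (scale β (κ y)) ≡⟨ scale-scale i β (κ y) ⟩
      scale (i * β) (κ y)    ∎
      where open ≡-Reasoning

  comb-κ𝟎ˡ : ∀ {n} a b (y : Vec K n) → comb a (κ 𝟎) b (κ y) ≡ scale b (κ y)
  comb-κ𝟎ˡ a b y = trans (cong (λ u → comb a u b (κ y)) κ-𝟎) (comb-𝟎ˡ a b (κ y))

  comb-κ𝟎ʳ : ∀ {n} a b (x : Vec K n) → comb a (κ x) b (κ 𝟎) ≡ scale a (κ x)
  comb-κ𝟎ʳ a b x = trans (comb-comm a b (κ x) (κ 𝟎)) (comb-κ𝟎ˡ b a x)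

  -- For copies of `κ` without origin: both ends of the secant must be nonzero.
  Fibre⁺ : ∀ {n} → K → K → Vec K (dbl n) → Set
  Fibre⁺ {n} α β v = ∃₂ λ (x y : Vec K n) → x ≢ 𝟎 × y ≢ 𝟎 × v ≡ comb α (κ x) β (κ y)

  fibre-cases : ∀ {n α β} → α ≢ 0# → β ≢ 0# → α + β ≢ 0# → (v : Vec K (dbl n)) →
    Fibre⁺ α β v ⊎ (∃ λ (z : Vec K n) → v ≡ scale α (κ z)) ⊎ (∃ λ (z : Vec K n) → v ≡ scale β (κ z))
  fibre-cases {α = α} {β} α≢0 β≢0 α+β≢0 v with κ-fibre α≢0 β≢0 α+β≢0 v
  ... | x , y , e with x ≟ᵛ 𝟎 | y ≟ᵛ 𝟎
  ... | yes refl | _        = inj₂ (inj₂ (y , trans e (comb-κ𝟎ˡ α β y)))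
  ... | no _     | yes refl = inj₂ (inj₁ (x , trans e (comb-κ𝟎ʳ α β x)))
  ... | no x≢𝟎   | no y≢𝟎   = inj₁ (x , y , x≢𝟎 , y≢𝟎 , e)

  -- By `κ-ratio` the scalar of a nonzero multiple of `κ z` is determined, so a secant through it
  -- could end in an origin only if γ were α or β.
  fibre-multiple : ∀ {n α β γ} {v} → α ≢ 0# → β ≢ 0# → α + β ≢ 0# → γ ≢ 0# → γ ≢ α → γ ≢ β →
    (z : Vec K n) → z ≢ 𝟎 → v ≡ scale γ (κ z) → Fibre⁺ {n} α β v
  fibre-multiple {n} {v = v} α≢0 β≢0 α+β≢0 γ≢0 γ≢α γ≢β z z≢𝟎 e with fibre-cases {n} α≢0 β≢0 α+β≢0 v
  ... | inj₁ f               = f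
  ... | inj₂ (inj₁ (y , e′)) = ⊥-elim (γ≢α (κ-ratio {y = y} γ≢0 z≢𝟎 (trans (sym e) e′)))
  ... | inj₂ (inj₂ (y , e′)) = ⊥-elim (γ≢β (κ-ratio {y = y} γ≢0 z≢𝟎 (trans (sym e) e′)))

  multiple≢𝟎 : ∀ {n c v} {z : Vec K n} → v ≢ 𝟎 → v ≡ scale c (κ z) → z ≢ 𝟎
  multiple≢𝟎 {c = c} v≢𝟎 e refl = v≢𝟎 (trans e (trans (cong (scale c) κ-𝟎) (scale-𝟎 c)))

  sum-one : ∀ α → α + (1# + α) ≡ 1#
  sum-one = solve 1 (λ α → α :+ (𝟙 :+ α) := 𝟙) refl

  sum-one≢0 : ∀ α → α + (1# + α) ≢ 0#
  sum-one≢0 α e = 1≢0 (trans (sym (sum-one α)) e)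

  1+≢0 : ∀ {α} → α ≢ 1# → 1# + α ≢ 0#
  1+≢0 α≢1 e = α≢1 (sym (+≡0⇒≡ e))

  own-fibre : ∀ {n} (v : Vec K (dbl n)) → ∃₂ λ α β → ∃₂ λ (x y : Vec K n) → α + β ≡ 1# × v ≡ comb α (κ x) β (κ y)
  -- Two values are to be avoided; repeating them fills the four places.
  own-fibre v with avoid-four 0# 1# 0# 1#
  ... | ω , ω≢0 , ω≢1 , _ with κ-fibre ω≢0 (1+≢0 ω≢1) (sum-one≢0 ω) v
  ... | x , y , e = ω , 1# + ω , x , y , sum-one ω , e

  own-fibre′ : ∀ {n} (v : Vec K (dbl (suc n))) → ∃₂ λ α β → ∃₂ λ x y → α + β ≡ 1# × v ≡ comb α (κ′ x) β (κ′ y)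
  own-fibre′ v with avoid-four 0# 1# 0# 1#
  ... | ω , ω≢0 , ω≢1 , _ with κ′-fibre ω≢0 (1+≢0 ω≢1) (sum-one≢0 ω) v
  ... | x , y , e = ω , 1# + ω , x , y , sum-one ω , e

  -- If the weights ω and 1 + ω lead to a removed origin, then `v` is a multiple of some `κ z` by
  -- one of them. Weights α and 1 + α with α outside 0, 1, ω, 1 + ω then work; this is where q > 4
  -- enters.
  own-fibre⁺ : ∀ {n} (v : Vec K (dbl n)) → v ≢ 𝟎 → ∃₂ λ α β → α + β ≡ 1# × Fibre⁺ {n} α β v
  own-fibre⁺ {n} v v≢𝟎 with avoid-four 0# 1# 0# 1#
  ... | ω , ω≢0 , ω≢1 , _ with avoid-four 0# 1# ω (1# + ω)
  ... | α , α≢0 , α≢1 , α≢ω , α≢1+ω with fibre-cases {n} ω≢0 (1+≢0 ω≢1) (sum-one≢0 ω) v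
  ... | inj₁ f = ω , 1# + ω , sum-one ω , f
  ... | inj₂ (inj₁ (z , e)) = α , 1# + α , sum-one α ,
    fibre-multiple α≢0 (1+≢0 α≢1) (sum-one≢0 α) ω≢0 (λ { refl → α≢ω refl })
      (λ e → α≢1+ω (combine₁ 1# e (solve 2 (λ α ω → α :+ (𝟙 :+ ω) := 𝟙 :* (ω :+ (𝟙 :+ α))) refl α ω)))
      z (multiple≢𝟎 v≢𝟎 e) e
  ... | inj₂ (inj₂ (z , e)) = α , 1# + α , sum-one α ,
    fibre-multiple α≢0 (1+≢0 α≢1) (sum-one≢0 α) (1+≢0 ω≢1) (λ e → α≢1+ω (sym e))
      (λ e → α≢ω (combine₁ 1# e (solve 2 (λ α ω → α :+ ω := 𝟙 :* (𝟙 :+ ω :+ (𝟙 :+ α))) refl α ω)))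
      z (multiple≢𝟎 v≢𝟎 e) e

  -- With μ different from 0 and 1, δ = μδ + (1 + μ)δ has two nonzero parts; removing the origin
  -- therefore loses no direction.
  direction-difference : ∀ {n} a (δ : Vec K n) → δ ≢ 𝟎 →
    ∃₂ λ x y → x ≢ 𝟎 × y ≢ 𝟎 × scale a (κ δ) ≡ comb a (κ x) a (κ y)
  direction-difference a δ δ≢𝟎 with avoid-four 0# 1# 0# 1#
  ... | μ , μ≢0 , μ≢1 , _ = scale μ δ , scale (1# + μ) δ ,
    (λ e → δ≢𝟎 (scale≡𝟎 μ≢0 e)) , (λ e → δ≢𝟎 (scale≡𝟎 (1+≢0 μ≢1) e)) ,
    trans (cong (λ x → scale a (κ x)) (split δ)) (sym (comb-κ a (scale μ δ) (scale (1# + μ) δ)))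
    where
    split : ∀ {n} (δ : Vec K n) → δ ≡ scale μ δ +ᵛ scale (1# + μ) δ
    split []      = refl
    split (x ∷ δ) = cong₂ _∷_ (solve 2 (λ x μ → x := μ :* x :+ (𝟙 :+ μ) :* x) refl x μ) (split δ)

  p-head : ∀ {p a b} → a + b ≡ 1# → p ≡ a * p + b * p
  p-head {p} {a} {b} h = combine₁ p h (solve 3 (λ p a b → p :+ (a :* p :+ b :* p) := p :* (a :+ b :+ 𝟙)) refl p a b)

  module _ {n} {f : Vec K n → Vec K (dbl n)} {p₁ p₂ : K} {R R′ : Vec K n → Set} {T : Vec K (dbl n) → Set} where

    covered-fst : ∀ {v a b x y} → R x → R y → a + b ≡ 1# → v ≡ comb a (κ x) b (κ y) →
      Covered (Step f p₁ p₂ R R′ T) (1# ∷ p₁ ∷ v)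
    covered-fst Rx Ry h e = covered-affine (fst Rx) (fst Ry) h (cong₂ _∷_ (p-head h) e)

    covered-snd : ∀ {v a b x y} → R x → R y → a + b ≡ 1# → v ≡ comb a (κ x) b (κ y) →
      Covered (Step f p₁ p₂ R R′ T) (1# ∷ p₂ ∷ v)
    covered-snd Rx Ry h e = covered-affine (snd Rx) (snd Ry) h (cong₂ _∷_ (p-head h) e)

    covered-both : ∀ {v a b d x y} → R x → R y → a + b ≡ 1# → d ≡ a * p₁ + b * p₂ → v ≡ comb a (κ x) b (κ y) →
      Covered (Step f p₁ p₂ R R′ T) (1# ∷ d ∷ v)
    covered-both Rx Ry h e₁ e = covered-affine (fst Rx) (snd Ry) h (cong₂ _∷_ e₁ e)

    covered-fst-third : ∀ {v b x y} → R x → R′ y → v ≡ comb 1# (κ x) b (f y) →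
      Covered (Step f p₁ p₂ R R′ T) (1# ∷ p₁ + b ∷ v)
    covered-fst-third Rx Ry e = covered-mixed (fst Rx) (affine (image Ry))
      (cong₂ _∷_ (solve 2 (λ p b → p :+ b := 𝟙 :* p :+ b :* 𝟙) refl p₁ _) e)

    covered-snd-third : ∀ {v b x y} → R x → R′ y → v ≡ comb 1# (κ x) b (f y) →
      Covered (Step f p₁ p₂ R R′ T) (1# ∷ p₂ + b ∷ v)
    covered-snd-third Rx Ry e = covered-mixed (snd Rx) (affine (image Ry))
      (cong₂ _∷_ (solve 2 (λ p b → p :+ b := 𝟙 :* p :+ b :* 𝟙) refl p₂ _) e)

    covered-third : ∀ {v a b x y} → R′ x → R′ y → a + b ≡ 1# → v ≡ comb a (f x) b (f y) →
      Covered (Step f p₁ p₂ R R′ T) (0# ∷ 1# ∷ v)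
    covered-third Rx Ry h e = covered-infinite (covered-affine (image Rx) (image Ry) h e)

  CoversUpToDirections : ∀ {n} → (Vec K (dbl n) → Set) → Set
  CoversUpToDirections {n} T = ∀ v → Covered T v ⊎ Direction {n} v

  private
    -- One of the secants through (1, υ, γ κ(z)) joining the first (left) or the second (right) family
    -- to the third one exists and avoids the removed origins.
    OtherSecant : K → K → K → Set
    OtherSecant η υ γ = (υ ≢ 1# × γ ≢ υ) ⊎ (η + υ ≢ 1# × γ ≢ η + υ)

    η+1≢1 : ∀ {η} → η ≢ 0# → η + 1# ≢ 1#
    η+1≢1 {η} η≢0 e = η≢0 (combine₁ 1# e (solve 1 (λ η → η :+ 𝟘 := 𝟙 :* (η :+ 𝟙 :+ 𝟙)) refl η))

    -- 1 + b and b are the scalars for which the secant joining the first two families ends in a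
    -- removed origin. For 1 + b, both replacement secants could fail only if η were 0, 1 or a root
    -- of X² + X + 1.
    other-secant₁ : ∀ {η υ b} → η ≢ 0# → η ≢ 1# → η * η + η ≢ 1# → η * b ≡ υ → OtherSecant η υ (1# + b)
    other-secant₁ {η} {υ} {b} η≢0 η≢1 η²+η≢1 ηb≡υ with υ ≟ 1#
    ... | yes refl = inj₂ (η+1≢1 η≢0 , λ e → η≢1 (square-injective (combine₂ 1# η ηb≡υ e
          (solve 2 (λ η b → η :* η :+ 𝟙 :* 𝟙 := 𝟙 :* (η :* b :+ 𝟙) :+ η :* (𝟙 :+ b :+ (η :+ 𝟙))) refl η b))))
    ... | no υ≢1 with (1# + b) ≟ υ
    ... | no  1+b≢υ = inj₁ (υ≢1 , 1+b≢υ)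
    ... | yes 1+b≡υ = inj₂
      ( (λ e → η²+η≢1 (combine₃ 1# (η + 1#) η ηb≡υ e 1+b≡υ
          (solve 3 (λ η b υ → η :* η :+ η :+ 𝟙 :=
            𝟙 :* (η :* b :+ υ) :+ (η :+ 𝟙) :* (η :+ υ :+ 𝟙) :+ η :* (𝟙 :+ b :+ υ)) refl η b υ)))
      , (λ e → η≢0 (combine₂ 1# 1# e 1+b≡υ
          (solve 3 (λ η b υ → η :+ 𝟘 := 𝟙 :* (𝟙 :+ b :+ (η :+ υ)) :+ 𝟙 :* (𝟙 :+ b :+ υ)) refl η b υ))) )

    other-secant₂ : ∀ {η υ b} → η ≢ 1# → η * η + η ≢ 1# → b ≢ 0# → η * b ≡ υ → OtherSecant η υ b
    other-secant₂ {η} {υ} {b} η≢1 η²+η≢1 b≢0 ηb≡υ with υ ≟ 1#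
    ... | no υ≢1   = inj₁ (υ≢1 , λ e → *-nonzero b≢0 (+-nonzero η≢1) (combine₂ 1# 1# ηb≡υ e
          (solve 3 (λ η b υ → b :* (η :+ 𝟙) :+ 𝟘 := 𝟙 :* (η :* b :+ υ) :+ 𝟙 :* (b :+ υ)) refl η b υ)))
    ... | yes refl = inj₂
      ( η+1≢1 (λ e → 0≢1 (trans (sym (zeroˡ b)) (trans (cong (_* b) (sym e)) ηb≡υ)))
      , (λ e → η²+η≢1 (combine₂ 1# η ηb≡υ e
          (solve 2 (λ η b → η :* η :+ η :+ 𝟙 := 𝟙 :* (η :* b :+ 𝟙) :+ η :* (b :+ (η :+ 𝟙))) refl η b))) )

  module _ {n} (T : Vec K (dbl n) → Set) (T-covers : CoversUpToDirections {n} T)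
           {η : K} (η≢0 : η ≢ 0#) (η≢1 : η ≢ 1#) (η²+η≢1 : η * η + η ≢ 1#) where

    Triangle : Vec K (dbl (suc n)) → Set
    Triangle = Step κ 0# η NonZeroᵛ NonZeroᵛ T

    private
      Vanishes : ∀ {m} → Vec K (suc (suc m)) → Set
      Vanishes (_ ∷ _ ∷ v) = v ≡ 𝟎

      Done : Vec K (dbl (suc n)) → Set
      Done v = Covered Triangle v ⊎ Vanishes v

      done-scale : ∀ c {v} → Done v → Done (scale c v)
      done-scale c {v} (inj₁ cov) = inj₁ (covered-scale c cov)
      done-scale c {_ ∷ _ ∷ _} (inj₂ refl) = inj₂ (scale-𝟎 c)

      via-fst-third : ∀ {υ} {v} → Fibre⁺ {n} 1# υ v → Covered Triangle (1# ∷ υ ∷ v)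
      via-fst-third {υ} {v} (x , y , x≢𝟎 , y≢𝟎 , e) =
        subst (λ d → Covered Triangle (1# ∷ d ∷ v)) (+-identityˡ υ) (covered-fst-third x≢𝟎 y≢𝟎 e)

      via-snd-third : ∀ {υ} {v} → Fibre⁺ {n} 1# (η + υ) v → Covered Triangle (1# ∷ υ ∷ v)
      via-snd-third {υ} {v} (x , y , x≢𝟎 , y≢𝟎 , e) =
        subst (λ d → Covered Triangle (1# ∷ d ∷ v))
          (solve 2 (λ η υ → η :+ (η :+ υ) := υ) refl η υ) (covered-snd-third x≢𝟎 y≢𝟎 e)

      generic : ∀ {υ} {v} → υ ≢ 0# → υ ≢ η → v ≢ 𝟎 → Covered Triangle (1# ∷ υ ∷ v)
      -- A point at height υ = ηb has weights 1 + b and b with respect to the heights 0 and η.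
      generic {υ} {v} υ≢0 υ≢η v≢𝟎 with divide υ η≢0
      ... | b , ηb≡υ = go (fibre-cases {n} 1+b≢0 b≢0 (λ e → 1≢0 (trans (sym 1+b+b≡1) e)) v)
        where
        b≢0 : b ≢ 0#
        b≢0 e = υ≢0 (trans (sym ηb≡υ) (trans (cong (η *_) e) (zeroʳ η)))
        b≢1 : b ≢ 1#
        b≢1 e = υ≢η (trans (sym ηb≡υ) (trans (cong (η *_) e) (*-identityʳ η)))
        1+b≢0 : 1# + b ≢ 0#
        1+b≢0 = 1+≢0 b≢1
        1+b≢1 : 1# + b ≢ 1#
        1+b≢1 e = b≢0 (combine₁ 1# e (solve 1 (λ b → b :+ 𝟘 := 𝟙 :* (𝟙 :+ b :+ 𝟙)) refl b))
        1+b+b≡1 : 1# + b + b ≡ 1#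
        1+b+b≡1 = solve 1 (λ b → 𝟙 :+ b :+ b := 𝟙) refl b

        other : ∀ {γ z} → γ ≢ 0# → γ ≢ 1# → OtherSecant η υ γ → v ≡ scale γ (κ z) → Covered Triangle (1# ∷ υ ∷ v)
        other {z = z} γ≢0 γ≢1 (inj₁ (υ≢1 , γ≢υ)) e = via-fst-third
          (fibre-multiple 1≢0 υ≢0 (1+≢0 υ≢1) γ≢0 γ≢1 γ≢υ z (multiple≢𝟎 v≢𝟎 e) e)
        other {z = z} γ≢0 γ≢1 (inj₂ (η+υ≢1 , γ≢η+υ)) e = via-snd-third
          (fibre-multiple 1≢0 (λ e → υ≢η (sym (+≡0⇒≡ e))) (1+≢0 η+υ≢1) γ≢0 γ≢1 γ≢η+υ z (multiple≢𝟎 v≢𝟎 e) e)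

        go : Fibre⁺ (1# + b) b v ⊎ (∃ λ z → v ≡ scale (1# + b) (κ z)) ⊎ (∃ λ z → v ≡ scale b (κ z)) →
             Covered Triangle (1# ∷ υ ∷ v)
        go (inj₁ (x , y , x≢𝟎 , y≢𝟎 , e)) = covered-both x≢𝟎 y≢𝟎 1+b+b≡1
          (combine₁ 1# ηb≡υ (solve 3 (λ η b υ → υ :+ ((𝟙 :+ b) :* 𝟘 :+ b :* η) := 𝟙 :* (η :* b :+ υ)) refl η b υ)) e
        go (inj₂ (inj₁ (z , e))) = other 1+b≢0 1+b≢1 (other-secant₁ η≢0 η≢1 η²+η≢1 ηb≡υ) e
        go (inj₂ (inj₂ (z , e))) = other b≢0 b≢1 (other-secant₂ η≢1 η²+η≢1 b≢0 ηb≡υ) e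

      done-affine : ∀ w → Done (1# ∷ w)
      done-affine (υ ∷ v) = cases (v ≟ᵛ 𝟎) (υ ≟ 0#) (υ ≟ η)
        where
        at-fst : (∃₂ λ α β → α + β ≡ 1# × Fibre⁺ {n} α β v) → Covered Triangle (1# ∷ 0# ∷ v)
        at-fst (_ , _ , h , x , y , x≢𝟎 , y≢𝟎 , e) = covered-fst x≢𝟎 y≢𝟎 h e
        at-snd : (∃₂ λ α β → α + β ≡ 1# × Fibre⁺ {n} α β v) → Covered Triangle (1# ∷ η ∷ v)
        at-snd (_ , _ , h , x , y , x≢𝟎 , y≢𝟎 , e) = covered-snd x≢𝟎 y≢𝟎 h e
        cases : Dec (v ≡ 𝟎) → Dec (υ ≡ 0#) → Dec (υ ≡ η) → Done (1# ∷ υ ∷ v)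
        cases (yes v≡𝟎) _          _          = inj₂ v≡𝟎
        cases (no v≢𝟎)  (yes refl) _          = inj₁ (at-fst (own-fibre⁺ v v≢𝟎))
        cases (no v≢𝟎)  (no _)     (yes refl) = inj₁ (at-snd (own-fibre⁺ v v≢𝟎))
        cases (no v≢𝟎)  (no υ≢0)   (no υ≢η)   = inj₁ (generic υ≢0 υ≢η v≢𝟎)

      done-infinite : ∀ w → Done (0# ∷ w)
      done-infinite = normalise (λ w → Done (0# ∷ w))
        (λ c {x} d → subst (λ h → Done (h ∷ scale c x)) (zeroʳ c) (done-scale c d))
        (λ v → on-third v (v ≟ᵛ 𝟎)) (λ v → at-vertex v (v ≟ᵛ 𝟎) (T-covers v))
        where
        at-third : ∀ {v} → (∃₂ λ α β → α + β ≡ 1# × Fibre⁺ {n} α β v) → Covered Triangle (0# ∷ 1# ∷ v)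
        at-third (_ , _ , h , x , y , x≢𝟎 , y≢𝟎 , e) = covered-third x≢𝟎 y≢𝟎 h e
        on-third : ∀ v → Dec (v ≡ 𝟎) → Done (0# ∷ 1# ∷ v)
        on-third v (yes v≡𝟎) = inj₂ v≡𝟎
        on-third v (no v≢𝟎)  = inj₁ (at-third (own-fibre⁺ v v≢𝟎))
        along : ∀ {a δ v} → v ≡ scale a (κ δ) →
          (∃₂ λ x y → x ≢ 𝟎 × y ≢ 𝟎 × scale a (κ δ) ≡ comb a (κ x) a (κ y)) → Covered Triangle (0# ∷ 0# ∷ v)
        along {a} e (x , y , x≢𝟎 , y≢𝟎 , e′) =
          covered-direction (fst x≢𝟎) (fst y≢𝟎) (cong₂ _∷_ (sym (x+x≡0 (a * 0#))) (trans e e′))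
        at-vertex : ∀ v → Dec (v ≡ 𝟎) → Covered T v ⊎ Direction {n} v → Done (0# ∷ 0# ∷ v)
        at-vertex v (yes v≡𝟎) _ = inj₂ v≡𝟎
        at-vertex v (no v≢𝟎) (inj₁ cov) = inj₁ (covered-infinite (covered-infinite cov))
        at-vertex v (no v≢𝟎) (inj₂ (a , δ , e)) = inj₁ (along e (direction-difference a δ (multiple≢𝟎 v≢𝟎 e)))

    -- The exceptional vectors with `v` ≡ `𝟎` form the line that carried the removed origins; they
    -- are left to the secants of the arc in `arcCap-covers`.
    triangle-covers : ∀ h d v → Covered Triangle (h ∷ d ∷ v) ⊎ v ≡ 𝟎
    triangle-covers h d v = normalise Done done-scale done-affine done-infinite (h ∷ d ∷ v)

-- A complete arc of PG(2,q) disjoint from the line at infinity, in affine coordinates. `spans`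
-- expresses completeness at affine points, `directions` at infinity.
record AffineArc {q : ℕ} (F : FieldOn q) (t : ℕ) : Set where
  open FieldOn F renaming (_⊕_ to infixl 6 _+_; _⊗_ to infixl 7 _*_)
  field
    c d        : Fin t → Fin q
    no-three   : ∀ {i j k α β} → α ≢ 0# → β ≢ 0# → α + β ≡ 1# →
                 c k ≡ α * c i + β * c j → d k ≡ α * d i + β * d j → i ≡ j
    spans      : ∀ x y → ∃₂ λ i j → ∃₂ λ α β → α + β ≡ 1# × x ≡ α * c i + β * c j × y ≡ α * d i + β * d j
    directions : ∀ x y → ∃₂ λ i j → ∃ λ α → x ≡ α * c i + α * c j × y ≡ α * d i + α * d j

-- The tower of caps covering all points that are not directions.

module Constructions {q : ℕ} (F : FieldOn q) (1+1≡0 : FieldOn._⊕_ F (FieldOn.1# F) (FieldOn.1# F) ≡ FieldOn.0# F) (4<q : 4 < q) where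
  open Char2 F 1+1≡0
  open Caps F 1+1≡0
  open Coverage F 1+1≡0 4<q

  -- The entries of (ax, ax²) are both zero or both nonzero.
  not-10 : ∀ {a x} → 1# ≡ a * x → 0# ≢ a * (x * x)
  not-10 {a} {x} e₁ e₂ = 0≢1 (combine₂ (1# + a * x) a e₁ e₂
    (solve 2 (λ a x → 𝟘 :+ 𝟙 := (𝟙 :+ a :* x) :* (𝟙 :+ a :* x) :+ a :* (𝟘 :+ a :* (x :* x))) refl a x))

  not-01 : ∀ {a x} → 0# ≡ a * x → 1# ≢ a * (x * x)
  not-01 {a} {x} e₁ e₂ = 0≢1 (combine₂ x 1# e₁ e₂
    (solve 2 (λ a x → 𝟘 :+ 𝟙 := x :* (𝟘 :+ a :* x) :+ 𝟙 :* (𝟙 :+ a :* (x :* x))) refl a x))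

  -- A direction (1, p, κ x) with x ≢ 𝟎 has scaling factor 1, which forces p = 1.
  not-1p : ∀ {n a p x} {xs ys : Vec K n} → p ≢ 1# → xs ≢ 𝟎 →
    1# ∷ p ∷ κ xs ≢ scale a (κ (x ∷ ys))
  not-1p {a = a} {p} {x} {xs} {ys} p≢1 xs≢𝟎 e = p≢1 (begin
    p             ≡⟨ ∷-injectiveˡ (∷-injectiveʳ e) ⟩
    a * (x * x)   ≡⟨ cong₂ (λ a x → a * (x * x)) a≡1 x≡1 ⟩
    1# * (1# * 1#) ≡⟨ trans (*-identityˡ _) (*-identityˡ _) ⟩
    1#            ∎)
    where
    open ≡-Reasoning
    a≡1 : a ≡ 1#
    a≡1 = κ-multiple {x = ys} xs≢𝟎 (∷-injectiveʳ (∷-injectiveʳ e))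
    x≡1 : x ≡ 1#
    x≡1 = trans (sym (*-identityˡ x)) (trans (cong (_* x) (sym a≡1)) (sym (∷-injectiveˡ e)))

  -- The points (1,0) and (0,1) of the projective line, which are precisely those not proportional
  -- to any (x, x²).
  Base : Vec K 2 → Set
  Base = Layer (_≡ 0# ∷ []) (Layer (λ _ → ⊤) (λ _ → ⊥))

  base-cap : Cap Base
  base-cap = layer-cap (λ { refl refl _ u≢v _ _ _ _ → u≢v refl }) (λ { refl refl u≢v _ _ _ → u≢v refl })
    (layer-cap (λ { {[]} {[]} _ _ _ u≢v _ _ _ _ → u≢v refl }) (λ { _ _ _ () })
      (record { nonzero = λ () ; distinct = λ () ; independent = λ () }))

  base-avoids : ∀ {v} → Base v → ¬ Direction {1} v
  base-avoids (affine refl)          (a , x ∷ [] , e) = not-10 (∷-injectiveˡ e) (∷-injectiveˡ (∷-injectiveʳ e))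
  base-avoids (infinite (affine {[]} _)) (a , x ∷ [] , e) = not-01 (∷-injectiveˡ e) (∷-injectiveˡ (∷-injectiveʳ e))

  base-covers : CoversUpToDirections {1} Base
  base-covers (c ∷ d ∷ []) with c ≟ 0# | d ≟ 0#
  ... | yes refl | _ = inj₁ (_ , _ , 0# , d , infinite (affine {u = []} tt) , infinite (affine {u = []} tt) ,
    cong₂ _∷_ (solve 1 (λ d → 𝟘 := 𝟘 :* 𝟘 :+ d :* 𝟘) refl d)
      (cong (_∷ []) (solve 1 (λ d → d := 𝟘 :* 𝟙 :+ d :* 𝟙) refl d)))
  ... | no _ | yes refl = inj₁ (_ , _ , 0# , c , affine refl , affine refl ,
    cong₂ _∷_ (solve 1 (λ c → c := 𝟘 :* 𝟙 :+ c :* 𝟙) refl c)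
      (cong (_∷ []) (solve 1 (λ c → 𝟘 := 𝟘 :* 𝟘 :+ c :* 𝟘) refl c)))
  -- With x = d/c and a = c/x one has c = ax and d = ax².
  ... | no c≢0 | no d≢0 = quotient (divide d c≢0)
    where
    quotient : (∃ λ x → c * x ≡ d) → Covered Base (c ∷ d ∷ []) ⊎ Direction (c ∷ d ∷ [])
    quotient (x , cx≡d) = scaling (divide c x≢0)
      where
      x≢0 : x ≢ 0#
      x≢0 refl = d≢0 (trans (sym cx≡d) (zeroʳ c))
      scaling : (∃ λ a → x * a ≡ c) → Covered Base (c ∷ d ∷ []) ⊎ Direction (c ∷ d ∷ [])
      scaling (a , xa≡c) = inj₂ (a , x ∷ [] , cong₂ _∷_ (trans (sym xa≡c) (*-comm x a)) (cong (_∷ [])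
        (combine₂ 1# x cx≡d xa≡c
          (solve 4 (λ a x c d → d :+ a :* (x :* x) := 𝟙 :* (c :* x :+ d) :+ x :* (x :* a :+ c)) refl a x c d))))

  module _ {p : K} (p≢0 : p ≢ 0#) (p≢1 : p ≢ 1#) where

    -- The origins of the first two families must go, since (1,r,0,...,0) is the direction
    -- r⁻¹(r,r²,0,...,0).
    Tower : ∀ n → Vec K (dbl (suc n)) → Set
    Tower zero    = Base
    Tower (suc n) = Step κ′ p (1# + p) NonZeroᵛ Everything (Tower n)

    private
      p≢1+p : p ≢ 1# + p
      p≢1+p e = 1≢0 (combine₁ 1# e (solve 1 (λ p → 𝟙 :+ 𝟘 := 𝟙 :* (p :+ (𝟙 :+ p))) refl p))
      1+p≢1 : 1# + p ≢ 1#
      1+p≢1 e = p≢0 (combine₁ 1# e (solve 1 (λ p → p :+ 𝟘 := 𝟙 :* (𝟙 :+ p :+ 𝟙)) refl p))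

    tower-avoids : ∀ n {v} → Tower n v → ¬ Direction {suc n} v
    tower-avoids zero    b = base-avoids b
    tower-avoids (suc n) (affine (fst x≢𝟎)) (a , x ∷ ys , e) = not-1p {ys = ys} p≢1 x≢𝟎 e
    tower-avoids (suc n) (affine (snd x≢𝟎)) (a , x ∷ ys , e) = not-1p {ys = ys} 1+p≢1 x≢𝟎 e
    tower-avoids (suc n) (infinite (affine _)) (a , x ∷ ys , e) = not-01 (∷-injectiveˡ e) (∷-injectiveˡ (∷-injectiveʳ e))
    tower-avoids (suc n) (infinite (infinite T)) (a , x ∷ ys , e) = tower-avoids n T (a , ys , ∷-injectiveʳ (∷-injectiveʳ e))

    -- Since p + (1 + p) = 1, a triple with one point in each family has scalar 1 and would equate a
    -- value of `κ′` with a value of `κ`.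
    tower-cap : ∀ n → Cap (Tower n)
    tower-cap zero    = base-cap
    tower-cap (suc n) = step-cap κ′-translationLike p≢1+p
      (λ {a} {δ} h _ e → κ′≢κ {y = δ} (trans e (trans (cong (λ a → scale a (κ δ)) (a≡1 {a} h)) (scale-1 (κ δ)))))
      (tower-cap n) (tower-avoids n)
      where
      a≡1 : ∀ {a} → a * (p + (1# + p)) ≡ 1# → a ≡ 1#
      a≡1 {a} h = trans (solve 2 (λ a p → a := a :* (p :+ (𝟙 :+ p))) refl a p) h

    tower-covers : ∀ n → CoversUpToDirections {suc n} (Tower n)
    tower-covers zero    = base-covers
    tower-covers (suc n) = normalise Done done-scale (λ { (d ∷ v) → finite d v }) at-infinity
      where
      S : Vec K (dbl (suc (suc n))) → Set
      S = Tower (suc n)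

      Done : Vec K (dbl (suc (suc n))) → Set
      Done v = Covered S v ⊎ Direction {suc (suc n)} v

      done-scale : ∀ c {v} → Done v → Done (scale c v)
      done-scale c (inj₁ cov) = inj₁ (covered-scale c cov)
      done-scale c (inj₂ dir) = inj₂ (direction-scale c dir)

      removed : ∀ {r} → r ≢ 0# → (∃ λ a → r * a ≡ 1#) → Direction {suc (suc n)} (1# ∷ r ∷ 𝟎)
      removed {r} r≢0 (a , ra≡1) = a , r ∷ 𝟎 , cong₂ _∷_ (trans (sym ra≡1) (*-comm r a))
        (cong₂ _∷_ (combine₁ r ra≡1 (solve 2 (λ r a → r :+ a :* (r :* r) := r :* (r :* a :+ 𝟙)) refl r a))
          (sym (trans (cong (scale a) (κ-𝟎 {suc n})) (scale-𝟎 a))))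

      at-fst : ∀ v → (∃₂ λ α β → α + β ≡ 1# × Fibre⁺ {suc n} α β v) → Covered S (1# ∷ p ∷ v)
      at-fst v (_ , _ , h , _ , _ , x≢𝟎 , y≢𝟎 , e) = covered-fst x≢𝟎 y≢𝟎 h e
      at-snd : ∀ v → (∃₂ λ α β → α + β ≡ 1# × Fibre⁺ {suc n} α β v) → Covered S (1# ∷ 1# + p ∷ v)
      at-snd v (_ , _ , h , _ , _ , x≢𝟎 , y≢𝟎 , e) = covered-snd x≢𝟎 y≢𝟎 h e

      -- If the secant joining the first two families passes through a removed point, then
      -- replacing that family by the third one works, since κ′ and κ have disjoint images.
      repair : ∀ {γ} {v : Vec K (dbl (suc n))} {z : Vec K (suc n)} → γ ≢ 0# → v ≡ scale γ (κ z) →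
        (∃₂ λ x y → v ≡ comb 1# (κ x) γ (κ′ y)) → ∃₂ λ x y → x ≢ 𝟎 × v ≡ comb 1# (κ x) γ (κ′ y)
      repair {γ} {v} {z} γ≢0 e (x , y , e′) = x , y , x≢𝟎 , e′
        where
        x≢𝟎 : x ≢ 𝟎
        x≢𝟎 refl = κ′≢κ {x = y} {z} (scale-injective γ≢0 (trans (sym (comb-𝟎ˡ 1# γ (κ′ y)))
          (trans (cong (λ u → comb 1# u γ (κ′ y)) (sym (κ-𝟎 {suc n}))) (trans (sym e′) e))))

      finite : ∀ d v → Done (1# ∷ d ∷ v)
      finite d v = cases (d ≟ p) (d ≟ (1# + p)) (v ≟ᵛ 𝟎)
        where
        generic : d ≢ p → d ≢ 1# + p → Covered S (1# ∷ d ∷ v)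
        generic d≢p d≢1+p = go (fibre-cases {suc n} α≢0 β≢0 (λ e → 1≢0 (trans (sym α+β≡1) e)) v)
          where
          -- These weights solve α + β = 1 and αp + β(1 + p) = d.
          β = p + d
          α = 1# + p + d
          α≢0 : α ≢ 0#
          α≢0 e = d≢1+p (sym (+≡0⇒≡ e))
          β≢0 : β ≢ 0#
          β≢0 e = d≢p (sym (+≡0⇒≡ e))
          α+β≡1 : α + β ≡ 1#
          α+β≡1 = solve 2 (λ p d → 𝟙 :+ p :+ d :+ (p :+ d) := 𝟙) refl p d
          1+α≢0 : 1# + α ≢ 0#
          1+α≢0 e = β≢0 (trans (solve 2 (λ p d → p :+ d := 𝟙 :+ (𝟙 :+ p :+ d)) refl p d) e)
          1+β≢0 : 1# + β ≢ 0#
          1+β≢0 e = α≢0 (trans (+-assoc 1# p d) e)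
          go : Fibre⁺ α β v ⊎ (∃ λ z → v ≡ scale α (κ z)) ⊎ (∃ λ z → v ≡ scale β (κ z)) → Covered S (1# ∷ d ∷ v)
          go (inj₁ (x , y , x≢𝟎 , y≢𝟎 , e)) = covered-both x≢𝟎 y≢𝟎 α+β≡1
            (solve 2 (λ p d → d := (𝟙 :+ p :+ d) :* p :+ (p :+ d) :* (𝟙 :+ p)) refl p d) e
          go (inj₂ (inj₁ (z , e))) with repair {z = z} α≢0 e (κκ′-fibre 1≢0 α≢0 1+α≢0 v)
          ... | x , y , x≢𝟎 , e′ = subst (λ d → Covered S (1# ∷ d ∷ v))
            (solve 2 (λ p d → 𝟙 :+ p :+ (𝟙 :+ p :+ d) := d) refl p d) (covered-snd-third {y = y} x≢𝟎 tt e′)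
          go (inj₂ (inj₂ (z , e))) with repair {z = z} β≢0 e (κκ′-fibre 1≢0 β≢0 1+β≢0 v)
          ... | x , y , x≢𝟎 , e′ = subst (λ d → Covered S (1# ∷ d ∷ v))
            (solve 2 (λ p d → p :+ (p :+ d) := d) refl p d) (covered-fst-third {y = y} x≢𝟎 tt e′)

        cases : Dec (d ≡ p) → Dec (d ≡ 1# + p) → Dec (v ≡ 𝟎) → Done (1# ∷ d ∷ v)
        cases (yes refl) _ (yes refl) = inj₂ (removed p≢0 (inverse p p≢0))
        cases (yes refl) _ (no v≢𝟎)   = inj₁ (at-fst v (own-fibre⁺ v v≢𝟎))
        cases (no _) (yes refl) (yes refl) = inj₂ (removed (1+≢0 p≢1) (inverse (1# + p) (1+≢0 p≢1)))
        cases (no _) (yes refl) (no v≢𝟎)   = inj₁ (at-snd v (own-fibre⁺ v v≢𝟎))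
        cases (no d≢p) (no d≢1+p) _        = inj₁ (generic d≢p d≢1+p)

      at-infinity : ∀ w → Done (0# ∷ w)
      at-infinity = normalise (λ w → Done (0# ∷ w))
        (λ c {x} d → subst (λ h → Done (h ∷ scale c x)) (zeroʳ c) (done-scale c d))
        (λ v → inj₁ (third (own-fibre′ v))) (λ v → deeper (tower-covers n v))
        where
        third : ∀ {v} → (∃₂ λ α β → ∃₂ λ x y → α + β ≡ 1# × v ≡ comb α (κ′ x) β (κ′ y)) → Covered S (0# ∷ 1# ∷ v)
        third (_ , _ , x , y , h , e) = covered-third {x = x} {y} tt tt h e
        deeper : ∀ {v} → Covered (Tower n) v ⊎ Direction {suc n} v → Done (0# ∷ 0# ∷ v)
        deeper (inj₁ cov) = inj₁ (covered-infinite (covered-infinite cov))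
        deeper (inj₂ (a , δ , e)) = inj₂ (a , 0# ∷ δ , cong₂ _∷_ (sym (zeroʳ a))
          (cong₂ _∷_ (solve 1 (λ a → 𝟘 := a :* (𝟘 :* 𝟘)) refl a) e))

-- The two complete caps.

module Complete {q : ℕ} (F : FieldOn q) (1+1≡0 : FieldOn._⊕_ F (FieldOn.1# F) (FieldOn.1# F) ≡ FieldOn.0# F) (4<q : 4 < q) where
  open Char2 F 1+1≡0
  open Caps F 1+1≡0
  open Coverage F 1+1≡0 4<q
  open Constructions F 1+1≡0 4<q

  -- A point at height ηb has weights 1 + b and b on a secant joining the two copies. For b = 0 and
  -- b = 1 one weight vanishes, and a secant inside a single copy replaces it.
  pair-covers : ∀ {n} {C : Vec K (suc (dbl n)) → Set} {η} → η ≢ 0# → ∀ w → Covered (Layer (Pair {n} 0# η Everything) C) (1# ∷ w)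
  pair-covers {n} {C} {η} η≢0 (d ∷ v) = go (divide d η≢0)
    where
    go : (∃ λ b → η * b ≡ d) → Covered (Layer (Pair {n} 0# η Everything) C) (1# ∷ d ∷ v)
    go (b , refl) = cases (b ≟ 0#) (b ≟ 1#)
      where
      Own : Set
      Own = ∃₂ λ α β → ∃₂ λ (x y : Vec K n) → α + β ≡ 1# × v ≡ comb α (κ x) β (κ y)
      at-0 : Own → Covered (Layer (Pair {n} 0# η Everything) C) (1# ∷ η * 0# ∷ v)
      at-0 (α , β , x , y , h , e) = covered-affine (fst {x = x} tt) (fst {x = y} tt) h
        (cong₂ _∷_ (solve 3 (λ η α β → η :* 𝟘 := α :* 𝟘 :+ β :* 𝟘) refl η α β) e)
      at-1 : Own → Covered (Layer (Pair {n} 0# η Everything) C) (1# ∷ η * 1# ∷ v)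
      at-1 (α , β , x , y , h , e) = covered-affine (snd {x = x} tt) (snd {x = y} tt) h
        (cong₂ _∷_ (combine₁ η h (solve 3 (λ η α β → η :* 𝟙 :+ (α :* η :+ β :* η) := η :* (α :+ β :+ 𝟙)) refl η α β)) e)
      between : (∃₂ λ (x y : Vec K n) → v ≡ comb (1# + b) (κ x) b (κ y)) → Covered (Layer (Pair {n} 0# η Everything) C) (1# ∷ η * b ∷ v)
      between (x , y , e) = covered-affine (fst {x = x} tt) (snd {x = y} tt) (solve 1 (λ b → 𝟙 :+ b :+ b := 𝟙) refl b)
        (cong₂ _∷_ (solve 2 (λ η b → η :* b := (𝟙 :+ b) :* 𝟘 :+ b :* η) refl η b) e)
      cases : Dec (b ≡ 0#) → Dec (b ≡ 1#) → Covered (Layer (Pair {n} 0# η Everything) C) (1# ∷ η * b ∷ v)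
      cases (yes refl) _          = at-0 (own-fibre v)
      cases (no _)     (yes refl) = at-1 (own-fibre v)
      cases (no b≢0)   (no b≢1)   = between (κ-fibre (1+≢0 b≢1) b≢0
        (λ e → 1≢0 (trans (solve 1 (λ b → 𝟙 := 𝟙 :+ b :+ b) refl b) e)) v)

  -- `κ-multiple` gives a = 1, and then aη = 1 makes η equal to 1.
  clash-free : ∀ {n η a} {δ y : Vec K n} → η ≢ 1# → a * (0# + η) ≡ 1# → y ≢ 𝟎 → κ y ≢ scale a (κ δ)
  clash-free {η = η} {a} {δ} η≢1 h y≢𝟎 e = η≢1
    (combine₂ 1# (η) h (κ-multiple {x = δ} y≢𝟎 e)
      (solve 2 (λ a η → η :+ 𝟙 := 𝟙 :* (a :* (𝟘 :+ η) :+ 𝟙) :+ η :* (a :+ 𝟙)) refl a η))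

  covered-along : ∀ {n C η a v} {δ : Vec K n} → v ≡ scale a (κ δ) → Covered (Layer (Pair {n} 0# η Everything) C) (0# ∷ 0# ∷ v)
  covered-along {a = a} {v} {δ} e = covered-direction (fst {x = δ} tt) (fst {x = 𝟎} tt) (cong₂ _∷_ (sym (x+x≡0 (a * 0#)))
    (trans e (sym (comb-κ𝟎ʳ a a δ))))

  module _ {p : K} (p≢0 : p ≢ 0#) (p≢1 : p ≢ 1#) {η : K} (η≢0 : η ≢ 0#) (η≢1 : η ≢ 1#) (n : ℕ) where

    -- The origin (0,1,0,...,0) of the third copy is left out because it lies on the secant joining
    -- the origins of the two full copies.
    ThreeCopies : Vec K (dbl (suc (suc n))) → Set
    ThreeCopies = Step κ 0# η Everything NonZeroᵛ (Tower p≢0 p≢1 n)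

    threeCopies-cap : Cap ThreeCopies
    threeCopies-cap = step-cap κ-translationLike (λ e → η≢0 (sym e)) (λ {_} {δ} → clash-free {δ = δ} η≢1)
      (tower-cap p≢0 p≢1 n) (tower-avoids p≢0 p≢1 n)

    threeCopies-covers : ∀ v → Covered ThreeCopies v
    threeCopies-covers = normalise (Covered ThreeCopies) covered-scale (pair-covers η≢0)
      (normalise (λ w → Covered ThreeCopies (0# ∷ w))
        (λ c {x} d → subst (λ h → Covered ThreeCopies (h ∷ scale c x)) (zeroʳ c) (covered-scale c d))
        (λ v → third v (v ≟ᵛ 𝟎)) (λ v → deeper (tower-covers p≢0 p≢1 n v)))
      where
      vertex : (∃ λ a → η * a ≡ 1#) → Covered ThreeCopies (0# ∷ 1# ∷ 𝟎)
      vertex (a , ηa≡1) = covered-direction (fst {x = 𝟎} tt) (snd {x = 𝟎} tt) (cong₂ _∷_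
        (combine₁ 1# ηa≡1 (solve 2 (λ η a → 𝟙 :+ (a :* 𝟘 :+ a :* η) := 𝟙 :* (η :* a :+ 𝟙)) refl η a))
        (sym (trans (comb-κ𝟎ʳ {suc n} a a 𝟎) (trans (cong (scale a) (κ-𝟎 {suc n})) (scale-𝟎 a)))))
      own : ∀ {v} → (∃₂ λ α β → α + β ≡ 1# × Fibre⁺ {suc n} α β v) → Covered ThreeCopies (0# ∷ 1# ∷ v)
      own (_ , _ , h , _ , _ , x≢𝟎 , y≢𝟎 , e) = covered-third x≢𝟎 y≢𝟎 h e
      third : ∀ v → Dec (v ≡ 𝟎) → Covered ThreeCopies (0# ∷ 1# ∷ v)
      third v (yes refl) = vertex (inverse η η≢0)
      third v (no v≢𝟎)   = own (own-fibre⁺ v v≢𝟎)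
      deeper : ∀ {v} → Covered (Tower p≢0 p≢1 n) v ⊎ Direction {suc n} v → Covered ThreeCopies (0# ∷ 0# ∷ v)
      deeper (inj₁ cov) = covered-infinite (covered-infinite cov)
      deeper (inj₂ (a , δ , e)) = covered-along {δ = δ} e

    module _ (η²+η≢1 : η * η + η ≢ 1#) {t} (A : AffineArc F t) where
      open AffineArc A

      data Cone : Vec K (dbl (suc (suc n))) → Set where
        cone : ∀ i (x : Vec K (suc n)) → Cone (c i ∷ d i ∷ κ x)

      private
        T₀ = Tower p≢0 p≢1 n

        Tri : Vec K (dbl (suc (suc n))) → Set
        Tri = Step κ 0# η NonZeroᵛ NonZeroᵛ T₀

      -- After the first coordinate, the next three are those of the plane of the arc; its external
      -- line, where the first of the three is 0, carries `Tri`.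
      ArcCap : Vec K (suc (suc (dbl (suc (suc n))))) → Set
      ArcCap = Layer (Pair {suc (suc n)} 0# 1# Everything) (Layer Cone Tri)

      private
        tri-avoids : ∀ {v} → Tri v → ¬ Direction {suc (suc n)} v
        tri-avoids (affine (fst x≢𝟎)) (a , x ∷ ys , e) = not-1p {ys = ys} 0≢1 x≢𝟎 e
        tri-avoids (affine (snd x≢𝟎)) (a , x ∷ ys , e) = not-1p {ys = ys} η≢1 x≢𝟎 e
        tri-avoids (infinite (affine _)) (a , x ∷ ys , e) = not-01 (∷-injectiveˡ e) (∷-injectiveˡ (∷-injectiveʳ e))
        tri-avoids (infinite (infinite T)) (a , x ∷ ys , e) =
          tower-avoids p≢0 p≢1 n T (a , ys , ∷-injectiveʳ (∷-injectiveʳ e))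

        tri-cap : Cap Tri
        tri-cap = step-cap κ-translationLike (λ e → η≢0 (sym e)) (λ {_} {δ} → clash-free {δ = δ} η≢1)
          (tower-cap p≢0 p≢1 n) (tower-avoids p≢0 p≢1 n)

      -- Directions of the outer pair that reach the cone have the form (1,δ,δ²,...), so the arc
      -- must miss the parabola d = c². A difference of cone points that hits one of the three
      -- copies in `Tri` has scalar 1 by `κ-multiple`; hence only the unscaled sums of arc points
      -- have to avoid (1,0), (0,1) and (1,η).
      arcCap-cap : (∀ i → d i ≢ c i * c i) →
        (∀ i j → c i + c j ≡ 1# → d i + d j ≢ 0#) →
        (∀ i j → c i + c j ≡ 0# → d i + d j ≢ 1#) →
        (∀ i j → c i + c j ≡ 1# → d i + d j ≢ η) → Cap ArcCap
      arcCap-cap off-parabola ≢X ≢Y ≢Z =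
        layer-cap (pair-independent 0≢1) avoids₀ (layer-cap cone-independent avoids₁ tri-cap)
        where
        cone-independent : AffinelyIndependent Cone
        cone-independent (cone i x) (cone j y) (cone k z) u≢v a≢0 b≢0 h e
          with no-three {k = k} a≢0 b≢0 h (∷-injectiveˡ e) (∷-injectiveˡ (∷-injectiveʳ e))
             | κ-affine {z = z} a≢0 b≢0 h (∷-injectiveʳ (∷-injectiveʳ e))
        ... | refl | refl = u≢v refl

        unscale : ∀ {a u i j} {x y z : Vec K (suc n)} → z ≢ 𝟎 → κ z ≡ comb a (κ x) a (κ y) → u ≡ a * i + a * j → i + j ≡ u
        unscale {a} {u} {i} {j} {x} {y} z≢𝟎 e h = combine₂ 1# (i + j) h
          (κ-multiple {x = x +ᵛ y} z≢𝟎 (trans e (comb-κ a x y)))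
          (solve 4 (λ a u i j → i :+ j :+ u := 𝟙 :* (u :+ (a :* i :+ a :* j)) :+ (i :+ j) :* (a :+ 𝟙)) refl a u i j)

        avoids₁ : AvoidsDirections Cone Tri
        avoids₁ (cone i x) (cone j y) _ (affine (fst z≢𝟎)) _ e = let e′ = ∷-injectiveʳ (∷-injectiveʳ e) in
          ≢X i j (unscale {x = x} {y} z≢𝟎 e′ (∷-injectiveˡ e)) (unscale {x = x} {y} z≢𝟎 e′ (∷-injectiveˡ (∷-injectiveʳ e)))
        avoids₁ (cone i x) (cone j y) _ (affine (snd z≢𝟎)) _ e = let e′ = ∷-injectiveʳ (∷-injectiveʳ e) in
          ≢Z i j (unscale {x = x} {y} z≢𝟎 e′ (∷-injectiveˡ e)) (unscale {x = x} {y} z≢𝟎 e′ (∷-injectiveˡ (∷-injectiveʳ e)))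
        avoids₁ (cone i x) (cone j y) _ (infinite (affine (image z≢𝟎))) _ e = let e′ = ∷-injectiveʳ (∷-injectiveʳ e) in
          ≢Y i j (unscale {x = x} {y} z≢𝟎 e′ (∷-injectiveˡ e)) (unscale {x = x} {y} z≢𝟎 e′ (∷-injectiveˡ (∷-injectiveʳ e)))
        avoids₁ {a = a} (cone i x) (cone j y) _ (infinite (infinite T)) _ e =
          tower-avoids p≢0 p≢1 n T (a , x +ᵛ y , trans (∷-injectiveʳ (∷-injectiveʳ e)) (comb-κ a x y))

        parallel : ∀ {r w a} {x y : Vec K (suc (suc n))} → Layer Cone Tri w → w ≢ comb a (r ∷ κ x) a (r ∷ κ y)
        parallel {r} {a = a} (affine _) e = 1≢0 (trans (∷-injectiveˡ e) (x+x≡0 (a * r)))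
        parallel {a = a} {x} {y} (infinite t) e = tri-avoids t (a , x +ᵛ y , trans (∷-injectiveʳ e) (comb-κ a x y))

        transversal : ∀ {w a} {x y : Vec K (suc (suc n))} → a ≢ 0# → Layer Cone Tri w → w ≢ comb a (0# ∷ κ x) a (1# ∷ κ y)
        transversal {a = a} {x ∷ _} {y ∷ _} _ (affine (cone i _)) e = off-parabola i
          (combine₃ (a * (x * x + y * y)) (c i + (a * x + a * y)) 1#
             (∷-injectiveˡ e) (∷-injectiveˡ (∷-injectiveʳ e)) (∷-injectiveˡ (∷-injectiveʳ (∷-injectiveʳ e)))
             (solve 5 (λ a c d x y → d :+ c :* c :=
               a :* (x :* x :+ y :* y) :* (𝟙 :+ (a :* 𝟘 :+ a :* 𝟙))
               :+ (c :+ (a :* x :+ a :* y)) :* (c :+ (a :* x :+ a :* y))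
               :+ 𝟙 :* (d :+ (a :* (x :* x) :+ a :* (y :* y)))) refl a (c i) (d i) x y))
        transversal {a = a} a≢0 (infinite _) e =
          a≢0 (trans (solve 1 (λ a → a := a :* 𝟘 :+ a :* 𝟙) refl a) (sym (∷-injectiveˡ e)))

        avoids₀ : AvoidsDirections (Pair 0# 1# Everything) (Layer Cone Tri)
        avoids₀ (fst {x} _) (fst {y} _) _ w _ e = parallel {x = x} {y} w e
        avoids₀ (snd {x} _) (snd {y} _) _ w _ e = parallel {x = x} {y} w e
        avoids₀ (fst {x} _) (snd {y} _) _ w a≢0 e = transversal {x = x} {y} a≢0 w e
        avoids₀ {u} {v} {a = a} (snd {x} _) (fst {y} _) _ w a≢0 e =
          transversal {x = y} {x} a≢0 w (trans e (comb-comm a a u v))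

      arcCap-covers : ∀ v → Covered ArcCap v
      arcCap-covers = normalise (Covered ArcCap) covered-scale (pair-covers 1≢0)
        (λ w → covered-infinite (normalise (Covered (Layer Cone Tri)) covered-scale
          (λ { (x ∷ y ∷ v) → finite v (spans x y) })
          (λ { (x ∷ y ∷ v) → at-infinity v (directions x y) (triangle-covers T₀ (tower-covers p≢0 p≢1 n) η≢0 η≢1 η²+η≢1 x y v) }) w))
        where
        S₁ = Layer Cone Tri

        own : ∀ i v → (∃₂ λ α β → ∃₂ λ (x y : Vec K (suc n)) → α + β ≡ 1# × v ≡ comb α (κ x) β (κ y)) →
          Covered S₁ (1# ∷ c i ∷ d i ∷ v)
        own i v (α , β , x , y , h , e) = covered-affine (cone i x) (cone i y) h
          (cong₂ _∷_ (p-head h) (cong₂ _∷_ (p-head h) e))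

        finite : ∀ {x y} v → (∃₂ λ i j → ∃₂ λ α β → α + β ≡ 1# × x ≡ α * c i + β * c j × y ≡ α * d i + β * d j) →
          Covered S₁ (1# ∷ x ∷ y ∷ v)
        -- If a weight vanishes, (x,y) is itself a point of the arc, and a secant inside the copy of
        -- `κ` above it is used.
        finite {x} {y} v (i , j , α , β , h , e₁ , e₂) = cases (α ≟ 0#) (β ≟ 0#)
          where
          β-only : ∀ r s → α ≡ 0# → s ≡ α * r + β * s
          β-only r s α≡0 = combine₂ s (r + s) h α≡0
            (solve 4 (λ α β r s → s :+ (α :* r :+ β :* s) := s :* (α :+ β :+ 𝟙) :+ (r :+ s) :* (α :+ 𝟘)) refl α β r s)
          α-only : ∀ r s → β ≡ 0# → r ≡ α * r + β * s
          α-only r s β≡0 = combine₂ r (r + s) h β≡0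
            (solve 4 (λ α β r s → r :+ (α :* r :+ β :* s) := r :* (α :+ β :+ 𝟙) :+ (r :+ s) :* (β :+ 𝟘)) refl α β r s)
          cases : Dec (α ≡ 0#) → Dec (β ≡ 0#) → Covered S₁ (1# ∷ x ∷ y ∷ v)
          cases (yes α≡0) _ = subst₂ (λ x y → Covered S₁ (1# ∷ x ∷ y ∷ v))
            (trans (β-only (c i) (c j) α≡0) (sym e₁)) (trans (β-only (d i) (d j) α≡0) (sym e₂)) (own j v (own-fibre v))
          cases (no _) (yes β≡0) = subst₂ (λ x y → Covered S₁ (1# ∷ x ∷ y ∷ v))
            (trans (α-only (c i) (c j) β≡0) (sym e₁)) (trans (α-only (d i) (d j) β≡0) (sym e₂)) (own i v (own-fibre v))
          cases (no α≢0) (no β≢0) = secant (κ-fibre α≢0 β≢0 (λ e → 1≢0 (trans (sym h) e)) v)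
            where
            secant : (∃₂ λ (x y : Vec K (suc n)) → v ≡ comb α (κ x) β (κ y)) → Covered S₁ (1# ∷ x ∷ y ∷ v)
            secant (x′ , y′ , e) = covered-affine (cone i x′) (cone j y′) h (cong₂ _∷_ e₁ (cong₂ _∷_ e₂ e))

        at-infinity : ∀ {x y} v → (∃₂ λ i j → ∃ λ α → x ≡ α * c i + α * c j × y ≡ α * d i + α * d j) →
          Covered Tri (x ∷ y ∷ v) ⊎ v ≡ 𝟎 → Covered S₁ (0# ∷ x ∷ y ∷ v)
        at-infinity v _ (inj₁ cov) = covered-infinite cov
        -- Over a point of the external line, a secant of the arc lifts to the origins above its two
        -- ends.
        at-infinity v (i , j , α , e₁ , e₂) (inj₂ refl) = covered-direction (cone i 𝟎) (cone j 𝟎)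
          (cong₂ _∷_ e₁ (cong₂ _∷_ e₂ (sym (trans (comb-κ𝟎ʳ {suc n} α α 𝟎) (trans (cong (scale α) (κ-𝟎 {suc n})) (scale-𝟎 α))))))

-- From a complete plane arc with fewer than q points to an affine arc.

module Arcs {q : ℕ} (F : FieldOn q) (1+1≡0 : FieldOn._⊕_ F (FieldOn.1# F) (FieldOn.1# F) ≡ FieldOn.0# F) where
  open Char2 F 1+1≡0

  module _ {n} (L : List (Vect F n)) (cap : IsCap F L) where
    private
      P = List.lookup L

    cap-nonproportional : ∀ {i j a b} → i ≢ j → b ≢ 0# → ¬ (∀ m → a * P i m + b * P j m ≡ 0#)
    cap-nonproportional {i} {j} {a} {b} i≢j b≢0 h with inverse b b≢0
    ... | r , br≡1 = proj₁ (proj₂ cap) i j i≢j (r * a , λ m → combine₂ (P j m) r br≡1 (h m)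
      (solve 5 (λ a b r x y → y :+ r :* a :* x := y :* (b :* r :+ 𝟙) :+ r :* (a :* x :+ b :* y :+ 𝟘))
        refl a b r (P i m) (P j m)))

    -- When `k` equals `i` or `j`, the relation collapses to one between two points, which
    -- nonproportionality excludes.
    cap-independent : ∀ {i j k a b c} → i ≢ j → a ≢ 0# → b ≢ 0# →
      ¬ (∀ m → a * P i m + b * P j m + c * P k m ≡ 0#)
    cap-independent {i} {j} {k} {a} {b} {c} i≢j a≢0 b≢0 h with k ≟ i | k ≟ j
    ... | yes refl | _ = cap-nonproportional {a = a + c} i≢j b≢0 λ m → trans
      (solve 5 (λ a b c x y → (a :+ c) :* x :+ b :* y := a :* x :+ b :* y :+ c :* x) refl a b c (P i m) (P j m)) (h m)
    ... | no _ | yes refl = cap-nonproportional {a = b + c} (λ e → i≢j (sym e)) a≢0 λ m → trans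
      (solve 5 (λ a b c x y → (b :+ c) :* y :+ a :* x := a :* x :+ b :* y :+ c :* y) refl a b c (P i m) (P j m)) (h m)
    ... | no k≢i | no k≢j = proj₂ (proj₂ cap) i j k i≢j (λ e → k≢i (sym e)) (λ e → k≢j (sym e))
      (a , b , c , (λ { (a≡0 , _) → a≢0 a≡0 }) , h)

  -- A finite search over indices and coefficients decides the claim; if it fails, `x` can be added
  -- to the cap, against maximality.
  complete⇒covered : ∀ {n} {L : List (Vect F n)} → IsCompleteCap F L → ∀ x → NonZero F x →
    ∃₂ λ i j → ∃₂ λ α β → ∀ m → x m ≡ α * List.lookup L i m + β * List.lookup L j m
  complete⇒covered {n} {L} (cap , complete) x x≢0
    with any? (λ i → any? λ j → any? λ α → any? λ β → all? λ m → x m ≟ (α * List.lookup L i m + β * List.lookup L j m))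
  ... | yes found = found
  ... | no  none  = ⊥-elim (complete x extended)
    where
    P = List.lookup L
    Uncovered : ∀ i j {α β} → ¬ (∀ m → x m ≡ α * P i m + β * P j m)
    Uncovered i j {α} {β} h = none (i , j , α , β , h)

    x-not-same : ∀ i → ¬ SamePoint F x (P i)
    x-not-same i (c , h) with c ≟ 0#
    ... | yes refl = proj₁ cap i (λ m → trans (h m) (zeroˡ _))
    ... | no  c≢0 with inverse c c≢0
    ... | r , cr≡1 = Uncovered i i {r} {0#} (λ m → combine₂ (x m) r cr≡1 (h m)
      (solve 4 (λ c r x y → x :+ (r :* y :+ 𝟘 :* y) := x :* (c :* r :+ 𝟙) :+ r :* (y :+ c :* x)) refl c r (x m) (P i m)))

    x-not-same′ : ∀ i → ¬ SamePoint F (P i) x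
    x-not-same′ i (c , h) = Uncovered i i {c} {0#} (λ m → trans (h m)
      (solve 2 (λ c y → c :* y := c :* y :+ 𝟘 :* y) refl c (P i m)))

    x-independent : ∀ i j {a b c} → i ≢ j → ¬ (a ≡ 0# × b ≡ 0# × c ≡ 0#) →
      ¬ (∀ m → a * x m + b * P i m + c * P j m ≡ 0#)
    x-independent i j {a} {b} {c} i≢j nontrivial h with a ≟ 0#
    ... | no a≢0 with inverse a a≢0
    ... | r , ar≡1 = Uncovered i j {r * b} {r * c} (λ m → combine₂ (x m) r ar≡1 (h m)
      (solve 7 (λ a b c r x y z → x :+ (r :* b :* y :+ r :* c :* z) :=
        x :* (a :* r :+ 𝟙) :+ r :* (a :* x :+ b :* y :+ c :* z :+ 𝟘)) refl a b c r (x m) (P i m) (P j m)))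
    x-independent i j {a} {b} {c} i≢j nontrivial h | yes refl with c ≟ 0# | b ≟ 0#
    ... | no c≢0 | _ = cap-nonproportional L cap {a = b} i≢j c≢0 (λ m → trans
      (solve 5 (λ b c x y z → b :* y :+ c :* z := 𝟘 :* x :+ b :* y :+ c :* z) refl b c (x m) (P i m) (P j m)) (h m))
    ... | yes refl | yes refl = nontrivial (refl , refl , refl)
    ... | yes refl | no b≢0 = proj₁ cap i (λ m → *≡0⇒≡0 b≢0 (trans
      (solve 4 (λ b x y z → b :* y := 𝟘 :* x :+ b :* y :+ 𝟘 :* z) refl b (x m) (P i m) (P j m)) (h m)))

    suc≢ : ∀ {k} {i j : Fin k} → suc i ≢ suc j → i ≢ j
    suc≢ i≢j refl = i≢j refl

    extended : IsCap F (x List.∷ L)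
    extended = nz , same , col
      where
      nz : ∀ i → NonZero F (List.lookup (x List.∷ L) i)
      nz zero    = x≢0
      nz (suc i) = proj₁ cap i
      same : ∀ i j → ¬ (i ≡ j) → ¬ SamePoint F (List.lookup (x List.∷ L) i) (List.lookup (x List.∷ L) j)
      same zero    zero    i≢j = ⊥-elim (i≢j refl)
      same zero    (suc j) i≢j = x-not-same j
      same (suc i) zero    i≢j = x-not-same′ i
      same (suc i) (suc j) i≢j = proj₁ (proj₂ cap) i j (suc≢ i≢j)
      col : ∀ i j k → ¬ (i ≡ j) → ¬ (i ≡ k) → ¬ (j ≡ k) →
        ¬ Collinear F (List.lookup (x List.∷ L) i) (List.lookup (x List.∷ L) j) (List.lookup (x List.∷ L) k)
      col zero zero k i≢j _ _ = ⊥-elim (i≢j refl)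
      col zero (suc j) zero _ i≢k _ = ⊥-elim (i≢k refl)
      col (suc i) zero zero _ _ j≢k = ⊥-elim (j≢k refl)
      col zero (suc j) (suc k) _ _ j≢k (a , b , c , nt , h) = x-independent j k (suc≢ j≢k) nt h
      col (suc i) zero (suc k) _ i≢k _ (a , b , c , nt , h) = x-independent i k {b} {a} {c} (suc≢ i≢k)
        (λ { (e₁ , e₂ , e₃) → nt (e₂ , e₁ , e₃) })
        (λ m → trans (cong (_+ c * P k m) (+-comm (b * x m) (a * P i m))) (h m))
      col (suc i) (suc j) zero i≢j _ _ (a , b , c , nt , h) = x-independent i j {c} {a} {b} (suc≢ i≢j)
        (λ { (e₁ , e₂ , e₃) → nt (e₂ , e₃ , e₁) })
        (λ m → trans (trans (+-assoc _ _ _) (+-comm (c * x m) (a * P i m + b * P j m))) (h m))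
      col (suc i) (suc j) (suc k) i≢j i≢k j≢k = proj₂ (proj₂ cap) i j k (suc≢ i≢j) (suc≢ i≢k) (suc≢ j≢k)

  private
    -- Each index with nonzero `y i` forbids a single value of a, namely the root of a linear
    -- equation, so fewer than q values are forbidden.
    avoid-root : ∀ {t} → t < q → (x y : Fin t → K) → ∃ λ a → ∀ i → y i ≢ 0# → x i + a * y i ≢ 0#
    avoid-root t<q x y = proj₁ found , avoided
      where
      root : ∀ i → Dec (y i ≡ 0#) → K
      root i (yes _)  = 0#
      root i (no y≢0) = proj₁ (divide (x i) y≢0)
      root-avoided : ∀ {a} i (y? : Dec (y i ≡ 0#)) → root i y? ≢ a → y i ≢ 0# → x i + a * y i ≢ 0#
      root-avoided i (yes y≡0) _ y≢0 _ = y≢0 y≡0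
      root-avoided {a} i (no y≢0′) r≢a _ e = r≢a (+≡0⇒≡ (*≡0⇒≡0 y≢0′
        (combine₂ 1# 1# (proj₂ (divide (x i) y≢0′)) e
          (solve 4 (λ x y r a → y :* (r :+ a) :+ 𝟘 := 𝟙 :* (y :* r :+ x) :+ 𝟙 :* (x :+ a :* y :+ 𝟘))
            refl (x i) (y i) (proj₁ (divide (x i) y≢0′)) a))))
      found = missing-value t<q (λ i → root i (y i ≟ 0#))
      avoided : ∀ i → y i ≢ 0# → x i + proj₁ found * y i ≢ 0#
      avoided i = root-avoided i (y i ≟ 0#) (proj₂ found i)

  pattern i₀ = zero
  pattern i₁ = suc zero
  pattern i₂ = suc (suc zero)

  -- First a, then b is chosen to avoid roots. A vector on the line would have third coordinate 0 by
  -- the choice of b, then second coordinate 0 by the choice of a, and so be zero.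
  external-line : ∀ {t} → t < q → (v : Fin t → Vect F 2) → (∀ i → NonZero F (v i)) →
    ∃₂ λ a b → ∀ i → v i i₀ + a * v i i₁ + b * v i i₂ ≢ 0#
  external-line t<q v v≢0 with avoid-root t<q (λ i → v i i₀) (λ i → v i i₁)
  ... | a , a-ok with avoid-root t<q (λ i → v i i₀ + a * v i i₁) (λ i → v i i₂)
  ... | b , b-ok = a , b , ok
    where
    ok : ∀ i → v i i₀ + a * v i i₁ + b * v i i₂ ≢ 0#
    ok i e with v i i₂ ≟ 0#
    ... | no  v₂≢0 = b-ok i v₂≢0 e
    ... | yes v₂≡0 = on-line (combine₂ 1# b e v₂≡0
          (solve 5 (λ a b x y z → x :+ a :* y :+ 𝟘 := 𝟙 :* (x :+ a :* y :+ b :* z :+ 𝟘) :+ b :* (z :+ 𝟘))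
            refl a b (v i i₀) (v i i₁) (v i i₂)))
      where
      on-line : v i i₀ + a * v i i₁ ≢ 0#
      on-line e′ with v i i₁ ≟ 0#
      ... | no  v₁≢0 = a-ok i v₁≢0 e′
      ... | yes v₁≡0 = v≢0 i λ { i₀ → combine₂ 1# a e′ v₁≡0
                (solve 3 (λ a x y → x :+ 𝟘 := 𝟙 :* (x :+ a :* y :+ 𝟘) :+ a :* (y :+ 𝟘)) refl a (v i i₀) (v i i₁))
            ; i₁ → v₁≡0 ; i₂ → v₂≡0 }

  module _ {L : List (Vect F 2)} (complete : IsCompleteCap F L) (a b : K) (r : Fin (List.length L) → K) where
    private
      P = List.lookup L
      u c d : Fin (List.length L) → K
      u i = P i i₀ + a * P i i₁ + b * P i i₂
      c i = r i * P i i₁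
      d i = r i * P i i₂

    -- The factor `r i` makes the linear form of the external line equal to 1 at the i-th point; its
    -- last two coordinates then become affine coordinates.
    normalised-arc : (∀ i → u i * r i ≡ 1#) → AffineArc F (List.length L)
    normalised-arc ur≡1 = record
      { c = c ; d = d ; no-three = no-three ; spans = spans ; directions = directions }
      where
      r≢0 : ∀ i → r i ≢ 0#
      r≢0 i e = 0≢1 (trans (sym (zeroʳ (u i))) (trans (cong (u i *_) (sym e)) (ur≡1 i)))

      first : ∀ i → r i * P i i₀ ≡ 1# + a * c i + b * d i
      first i = combine₁ 1# (ur≡1 i)
        (solve 6 (λ a b r x y z → r :* x :+ (𝟙 :+ a :* (r :* y) :+ b :* (r :* z)) := 𝟙 :* ((x :+ a :* y :+ b :* z) :* r :+ 𝟙))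
          refl a b (r i) (P i i₀) (P i i₁) (P i i₂))

      no-three : ∀ {i j k α β} → α ≢ 0# → β ≢ 0# → α + β ≡ 1# →
        c k ≡ α * c i + β * c j → d k ≡ α * d i + β * d j → i ≡ j
      no-three {i} {j} {k} {α} {β} α≢0 β≢0 α+β≡1 e₁ e₂ with i ≟ j
      ... | yes i≡j = i≡j
      ... | no  i≢j = ⊥-elim (cap-independent L (proj₁ complete) {c = r k} i≢j (*-nonzero α≢0 (r≢0 i)) (*-nonzero β≢0 (r≢0 j))
            λ { i₀ → zeroth ; i₁ → later e₁ ; i₂ → later e₂ })
        where
        later : ∀ {x y z} → r k * z ≡ α * (r i * x) + β * (r j * y) → α * r i * x + β * r j * y + r k * z ≡ 0#
        later {x} {y} {z} e = combine₁ 1# e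
          (solve 7 (λ α β rᵢ rⱼ x y w → α :* rᵢ :* x :+ β :* rⱼ :* y :+ w :+ 𝟘 := 𝟙 :* (w :+ (α :* (rᵢ :* x) :+ β :* (rⱼ :* y))))
            refl α β (r i) (r j) x y (r k * z))
        zeroth : α * r i * P i i₀ + β * r j * P j i₀ + r k * P k i₀ ≡ 0#
        zeroth = later (begin
          r k * P k i₀                                             ≡⟨ first k ⟩
          1# + a * c k + b * d k                                   ≡⟨ combine₃ 1# a b α+β≡1 e₁ e₂ identity ⟩
          α * (1# + a * c i + b * d i) + β * (1# + a * c j + b * d j) ≡⟨ cong₂ (λ s t → α * s + β * t) (first i) (first j) ⟨
          α * (r i * P i i₀) + β * (r j * P j i₀)                  ∎)
          where
          open ≡-Reasoning
          identity : 1# + a * c k + b * d k + (α * (1# + a * c i + b * d i) + β * (1# + a * c j + b * d j)) ≡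
            1# * (α + β + 1#) + a * (c k + (α * c i + β * c j)) + b * (d k + (α * d i + β * d j))
          identity = solve 10 (λ a b α β cᵢ cⱼ cₖ dᵢ dⱼ dₖ →
            𝟙 :+ a :* cₖ :+ b :* dₖ :+ (α :* (𝟙 :+ a :* cᵢ :+ b :* dᵢ) :+ β :* (𝟙 :+ a :* cⱼ :+ b :* dⱼ)) :=
            𝟙 :* (α :+ β :+ 𝟙) :+ a :* (cₖ :+ (α :* cᵢ :+ β :* cⱼ)) :+ b :* (dₖ :+ (α :* dᵢ :+ β :* dⱼ)))
            refl a b α β (c i) (c j) (c k) (d i) (d j) (d k)

      module _ {h x y : K} where
        private
          X : Vect F 2
          -- Chosen so that the linear form takes the value h at `X`: 1 for affine points, 0 for
          -- points at infinity.
          X i₀ = h + a * x + b * y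
          X i₁ = x
          X i₂ = y

        combination : NonZero F X →
          ∃₂ λ i j → ∃₂ λ α β → α + β ≡ h × x ≡ α * c i + β * c j × y ≡ α * d i + β * d j
        combination X≢0 with complete⇒covered {L = L} complete X X≢0
        ... | i , j , α , β , e = i , j , α * u i , β * u j , sums , coordinate (e i₁) , coordinate (e i₂)
          where
          coordinate : ∀ {z s t} → z ≡ α * s + β * t → z ≡ α * u i * (r i * s) + β * u j * (r j * t)
          coordinate {z} {s} {t} e = combine₃ (α * s) (β * t) 1# (ur≡1 i) (ur≡1 j) e
            (solve 9 (λ α β uᵢ rᵢ uⱼ rⱼ s t z → z :+ (α :* uᵢ :* (rᵢ :* s) :+ β :* uⱼ :* (rⱼ :* t)) :=
              α :* s :* (uᵢ :* rᵢ :+ 𝟙) :+ β :* t :* (uⱼ :* rⱼ :+ 𝟙) :+ 𝟙 :* (z :+ (α :* s :+ β :* t)))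
              refl α β (u i) (r i) (u j) (r j) s t z)
          sums : α * u i + β * u j ≡ h
          sums = combine₃ 1# a b (e i₀) (e i₁) (e i₂)
            (expand (P i i₀) (P i i₁) (P i i₂) (P j i₀) (P j i₁) (P j i₂))
            where
            expand : ∀ p₀ p₁ p₂ s₀ s₁ s₂ →
              α * (p₀ + a * p₁ + b * p₂) + β * (s₀ + a * s₁ + b * s₂) + h ≡
              1# * (h + a * x + b * y + (α * p₀ + β * s₀)) + a * (x + (α * p₁ + β * s₁)) + b * (y + (α * p₂ + β * s₂))
            expand p₀ p₁ p₂ s₀ s₁ s₂ = begin
              α * (p₀ + a * p₁ + b * p₂) + β * (s₀ + a * s₁ + b * s₂) + h
                ≡⟨ cong (_+ h) (solve 10 (λ α β a b p₀ p₁ p₂ s₀ s₁ s₂ →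
                     α :* (p₀ :+ a :* p₁ :+ b :* p₂) :+ β :* (s₀ :+ a :* s₁ :+ b :* s₂) :=
                     (α :* p₀ :+ β :* s₀) :+ a :* (α :* p₁ :+ β :* s₁) :+ b :* (α :* p₂ :+ β :* s₂))
                     refl α β a b p₀ p₁ p₂ s₀ s₁ s₂) ⟩
              (α * p₀ + β * s₀) + a * (α * p₁ + β * s₁) + b * (α * p₂ + β * s₂) + h
                ≡⟨ solve 8 (λ a b h x y k l m → k :+ a :* l :+ b :* m :+ h :=
                     𝟙 :* (h :+ a :* x :+ b :* y :+ k) :+ a :* (x :+ l) :+ b :* (y :+ m))
                     refl a b h x y (α * p₀ + β * s₀) (α * p₁ + β * s₁) (α * p₂ + β * s₂) ⟩
              1# * (h + a * x + b * y + (α * p₀ + β * s₀)) + a * (x + (α * p₁ + β * s₁)) + b * (y + (α * p₂ + β * s₂)) ∎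
              where open ≡-Reasoning

      spans : ∀ x y → ∃₂ λ i j → ∃₂ λ α β → α + β ≡ 1# × x ≡ α * c i + β * c j × y ≡ α * d i + β * d j
      spans x y = combination λ X≡0 → 1≢0 (combine₃ 1# a b (X≡0 i₀) (X≡0 i₁) (X≡0 i₂)
        (solve 4 (λ a b x y → 𝟙 :+ 𝟘 := 𝟙 :* (𝟙 :+ a :* x :+ b :* y :+ 𝟘) :+ a :* (x :+ 𝟘) :+ b :* (y :+ 𝟘)) refl a b x y))

      directions : ∀ x y → ∃₂ λ i j → ∃ λ α → x ≡ α * c i + α * c j × y ≡ α * d i + α * d j
      directions x y = cases (x ≟ 0#) (y ≟ 0#)
        where
        Result = ∃₂ λ i j → ∃ λ α → x ≡ α * c i + α * c j × y ≡ α * d i + α * d j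
        some-point : (∃₂ λ i j → ∃₂ λ α β → α + β ≡ 1# × 0# ≡ α * c i + β * c j × 0# ≡ α * d i + β * d j) → Fin (List.length L)
        some-point (i , _) = i
        equalise : (∃₂ λ i j → ∃₂ λ α β → α + β ≡ 0# × x ≡ α * c i + β * c j × y ≡ α * d i + β * d j) → Result
        equalise (i , j , α , β , α+β≡0 , e₁ , e₂) with +≡0⇒≡ α+β≡0
        ... | refl = i , j , α , e₁ , e₂
        cases : Dec (x ≡ 0#) → Dec (y ≡ 0#) → Result
        -- The zero vector only asks for some index; `spans` shows that one exists.
        cases (yes x≡0) (yes y≡0) = let i = some-point (spans 0# 0#) in
          i , i , 0# , trans x≡0 (sym (x+x≡0 _)) , trans y≡0 (sym (x+x≡0 _))
        cases (no x≢0) _ = equalise (combination λ X≡0 → x≢0 (X≡0 i₁))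
        cases (yes _) (no y≢0) = equalise (combination λ X≡0 → y≢0 (X≡0 i₂))

  affine-arc : ∀ {L : List (Vect F 2)} → IsCompleteCap F L → List.length L < q → AffineArc F (List.length L)
  affine-arc {L} complete t<q with external-line t<q (List.lookup L) (proj₁ (proj₁ complete))
  ... | a , b , u≢0 = normalised-arc complete a b (λ i → proj₁ (inverse _ (u≢0 i))) (λ i → proj₂ (inverse _ (u≢0 i)))

-- Coordinates in which three prescribed vectors are not sums of arc points.

module NormalForm {q : ℕ} (F : FieldOn q) (1+1≡0 : FieldOn._⊕_ F (FieldOn.1# F) (FieldOn.1# F) ≡ FieldOn.0# F) where
  open Char2 F 1+1≡0

  -- An invertible affine map preserves secants and the line at infinity; here its linear part is
  -- triangular and its shift affects the second coordinate.
  transform : ∀ {t} m₁ m₂ m₃ s → m₁ ≢ 0# → m₃ ≢ 0# → AffineArc F t → AffineArc F t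
  transform m₁ m₂ m₃ s m₁≢0 m₃≢0 A = record
    { c = λ i → m₁ * c i + m₂ * d i
    ; d = λ i → m₃ * d i + s
    ; no-three = no-three′
    ; spans = λ x y → spans′ x y (divide (y + s) m₃≢0)
    ; directions = λ x y → directions′ x y (divide y m₃≢0) }
    where
    open AffineArc A
    no-three′ : ∀ {i j k α β} → α ≢ 0# → β ≢ 0# → α + β ≡ 1# →
      m₁ * c k + m₂ * d k ≡ α * (m₁ * c i + m₂ * d i) + β * (m₁ * c j + m₂ * d j) →
      m₃ * d k + s ≡ α * (m₃ * d i + s) + β * (m₃ * d j + s) → i ≡ j
    no-three′ {i} {j} {k} {α} {β} α≢0 β≢0 h e₁ e₂ = no-three α≢0 β≢0 h c≡ d≡
      where
      d≡ : d k ≡ α * d i + β * d j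
      d≡ = +≡0⇒≡ (*≡0⇒≡0 m₃≢0 (combine₂ s 1# h e₂
        (solve 7 (λ α β m s x y z → m :* (z :+ (α :* x :+ β :* y)) :+ 𝟘 :=
          s :* (α :+ β :+ 𝟙) :+ 𝟙 :* (m :* z :+ s :+ (α :* (m :* x :+ s) :+ β :* (m :* y :+ s))))
          refl α β m₃ s (d i) (d j) (d k))))
      c≡ : c k ≡ α * c i + β * c j
      c≡ = +≡0⇒≡ (*≡0⇒≡0 m₁≢0 (combine₂ m₂ 1# d≡ e₁
        (solve 10 (λ α β m₁ m₂ cᵢ cⱼ cₖ dᵢ dⱼ dₖ → m₁ :* (cₖ :+ (α :* cᵢ :+ β :* cⱼ)) :+ 𝟘 :=
          m₂ :* (dₖ :+ (α :* dᵢ :+ β :* dⱼ))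
          :+ 𝟙 :* (m₁ :* cₖ :+ m₂ :* dₖ :+ (α :* (m₁ :* cᵢ :+ m₂ :* dᵢ) :+ β :* (m₁ :* cⱼ :+ m₂ :* dⱼ))))
          refl α β m₁ m₂ (c i) (c j) (c k) (d i) (d j) (d k))))

    first-coordinate : ∀ {x x₀ y₀ α β i j} → m₁ * x₀ ≡ x + m₂ * y₀ → x₀ ≡ α * c i + β * c j → y₀ ≡ α * d i + β * d j →
      x ≡ α * (m₁ * c i + m₂ * d i) + β * (m₁ * c j + m₂ * d j)
    first-coordinate {x} {x₀} {y₀} {α} {β} {i} {j} h refl refl = combine₁ 1# h
      (solve 9 (λ x α β m₁ m₂ cᵢ cⱼ dᵢ dⱼ → x :+ (α :* (m₁ :* cᵢ :+ m₂ :* dᵢ) :+ β :* (m₁ :* cⱼ :+ m₂ :* dⱼ)) :=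
        𝟙 :* (m₁ :* (α :* cᵢ :+ β :* cⱼ) :+ (x :+ m₂ :* (α :* dᵢ :+ β :* dⱼ))))
        refl x α β m₁ m₂ (c i) (c j) (d i) (d j))

    spans′ : ∀ x y → (∃ λ y₀ → m₃ * y₀ ≡ y + s) → ∃₂ λ i j → ∃₂ λ α β → α + β ≡ 1# ×
      x ≡ α * (m₁ * c i + m₂ * d i) + β * (m₁ * c j + m₂ * d j) × y ≡ α * (m₃ * d i + s) + β * (m₃ * d j + s)
    spans′ x y (y₀ , h) with divide (x + m₂ * y₀) m₁≢0
    ... | x₀ , h′ with spans x₀ y₀
    ... | i , j , α , β , α+β≡1 , e₁ , e₂ = i , j , α , β , α+β≡1 , first-coordinate h′ e₁ e₂ ,
      combine₃ s m₃ 1# α+β≡1 e₂ h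
        (solve 8 (λ α β m s y y₀ dᵢ dⱼ → y :+ (α :* (m :* dᵢ :+ s) :+ β :* (m :* dⱼ :+ s)) :=
          s :* (α :+ β :+ 𝟙) :+ m :* (y₀ :+ (α :* dᵢ :+ β :* dⱼ)) :+ 𝟙 :* (m :* y₀ :+ (y :+ s)))
          refl α β m₃ s y y₀ (d i) (d j))

    directions′ : ∀ x y → (∃ λ y₀ → m₃ * y₀ ≡ y) → ∃₂ λ i j → ∃ λ α →
      x ≡ α * (m₁ * c i + m₂ * d i) + α * (m₁ * c j + m₂ * d j) × y ≡ α * (m₃ * d i + s) + α * (m₃ * d j + s)
    directions′ x y (y₀ , h) with divide (x + m₂ * y₀) m₁≢0
    ... | x₀ , h′ with directions x₀ y₀
    ... | i , j , α , e₁ , e₂ = i , j , α , first-coordinate h′ e₁ e₂ ,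
      combine₂ m₃ 1# e₂ h
        (solve 7 (λ α m s y y₀ dᵢ dⱼ → y :+ (α :* (m :* dᵢ :+ s) :+ α :* (m :* dⱼ :+ s)) :=
          m :* (y₀ :+ (α :* dᵢ :+ α :* dⱼ)) :+ 𝟙 :* (m :* y₀ :+ y))
          refl α m₃ s y y₀ (d i) (d j))

  IsSum : ∀ {t} → AffineArc F t → K → K → Set
  IsSum A x y = ∃₂ λ i j → c i + c j ≡ x × d i + d j ≡ y
    where open AffineArc A

  module _ {t} (A : AffineArc F t) {y₁ y₂ : K} (y≢0 : ¬ (y₁ ≡ 0# × y₂ ≡ 0#)) where
    open AffineArc A
    private
      _~[_]_ : Fin t → K → Fin t → Set
      i ~[ ν ] j = ν ≢ 0# × c i + c j ≡ ν * y₁ × d i + d j ≡ ν * y₂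

      ~-sym : ∀ {ν i j} → i ~[ ν ] j → j ~[ ν ] i
      ~-sym (ν≢0 , e₁ , e₂) = ν≢0 , trans (+-comm _ _) e₁ , trans (+-comm _ _) e₂

      ~-irrefl : ∀ {ν i j} → i ~[ ν ] j → i ≢ j
      ~-irrefl (ν≢0 , e₁ , e₂) refl = y≢0 (*≡0⇒≡0 ν≢0 (trans (sym e₁) (x+x≡0 _)) , *≡0⇒≡0 ν≢0 (trans (sym e₂) (x+x≡0 _)))

      -- Points i, j and j′ would lie on a line in the direction (y₁ , y₂).
      ~-unique : ∀ {ν ν′ i j j′} → i ~[ ν ] j → i ~[ ν′ ] j′ → ν ≡ ν′
      ~-unique {ν} {ν′} {i} {j} {j′} p@(ν≢0 , e₁ , e₂) (ν′≢0 , e₁′ , e₂′) with ν ≟ ν′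
      ... | yes ν≡ν′ = ν≡ν′
      ... | no  ν≢ν′ with divide ν′ ν≢0
      ... | β , νβ≡ν′ = ⊥-elim (~-irrefl p (no-three {k = j′} 1+β≢0 β≢0
              (solve 1 (λ β → 𝟙 :+ β :+ β := 𝟙) refl β) (on-line e₁ e₁′) (on-line e₂ e₂′)))
        where
        β≢0 : β ≢ 0#
        β≢0 refl = ν′≢0 (trans (sym νβ≡ν′) (zeroʳ ν))
        1+β≢0 : 1# + β ≢ 0#
        1+β≢0 e with +≡0⇒≡ e
        ... | refl = ν≢ν′ (trans (sym (*-identityʳ ν)) νβ≡ν′)
        on-line : ∀ {a b b′ y} → a + b ≡ ν * y → a + b′ ≡ ν′ * y → b′ ≡ (1# + β) * a + β * b
        on-line {a} {b} {b′} {y} e e′ = combine₃ β 1# y e e′ νβ≡ν′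
          (solve 7 (λ a b b′ y ν ν′ β → b′ :+ ((𝟙 :+ β) :* a :+ β :* b) :=
            β :* (a :+ b :+ ν :* y) :+ 𝟙 :* (a :+ b′ :+ ν′ :* y) :+ y :* (ν :* β :+ ν′)) refl a b b′ y ν ν′ β)

      -- The excluded scalars: 0, 1 and the roots ρ, 1 + ρ of X² + X + 1. Without roots the last two
      -- places repeat 0.
      special : (∃ λ ρ → ρ * ρ + ρ ≡ 1#) ⊎ ⊤ → Fin 4 → K
      special _ zero                               = 0#
      special _ (suc zero)                         = 1#
      special (inj₁ (ρ , _)) (suc (suc zero))      = ρ
      special (inj₁ (ρ , _)) (suc (suc (suc zero))) = 1# + ρ
      special (inj₂ _) (suc (suc _))               = 0#

      Good : K → Set
      Good ν = ν ≢ 0# × ν ≢ 1# × ν * ν + ν ≢ 1# × ¬ IsSum A (ν * y₁) (ν * y₂)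

      sum? : ∀ ν → Dec (IsSum A (ν * y₁) (ν * y₂))
      sum? ν = any? λ i → any? λ j → ((c i + c j) ≟ (ν * y₁)) ×-dec ((d i + d j) ≟ (ν * y₂))

      good? : ∀ ν → Dec (Good ν)
      good? ν = ¬? (ν ≟ 0#) ×-dec ¬? (ν ≟ 1#) ×-dec ¬? ((ν * ν + ν) ≟ 1#) ×-dec ¬? (sum? ν)

      root-unique : ∀ {ν ρ} → ν * ν + ν ≡ 1# → ρ * ρ + ρ ≡ 1# → ν ≢ ρ → 1# + ρ ≡ ν
      root-unique {ν} {ρ} e e′ ν≢ρ = +≡0⇒≡ (*≡0⇒≡0 (+-nonzero ν≢ρ) (combine₂ 1# 1# e e′
        (solve 2 (λ ν ρ → (ν :+ ρ) :* (𝟙 :+ ρ :+ ν) :+ 𝟘 := 𝟙 :* (ν :* ν :+ ν :+ 𝟙) :+ 𝟙 :* (ρ :* ρ :+ ρ :+ 𝟙)) refl ν ρ)))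

      classify : (root? : Dec (∃ λ ρ → ρ * ρ + ρ ≡ 1#)) → ¬ (∃ Good) →
        ∃ λ (sp : Fin 4 → K) → ∀ ν → (∃ λ k → sp k ≡ ν) ⊎ (∃₂ λ i j → i ≢ j × i ~[ ν ] j)
      classify root? none = sp , choose
        where
        roots : Dec (∃ λ ρ → ρ * ρ + ρ ≡ 1#) → (∃ λ ρ → ρ * ρ + ρ ≡ 1#) ⊎ ⊤
        roots (yes r) = inj₁ r
        roots (no _)  = inj₂ tt
        sp = special (roots root?)
        root-special : ∀ {ν} → ν * ν + ν ≡ 1# → (r? : Dec (∃ λ ρ → ρ * ρ + ρ ≡ 1#)) → ∃ λ k → special (roots r?) k ≡ ν
        root-special {ν} e (no ¬r) = ⊥-elim (¬r (ν , e))
        root-special {ν} e (yes (ρ , e′)) with ν ≟ ρ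
        ... | yes ν≡ρ = suc (suc zero) , sym ν≡ρ
        ... | no  ν≢ρ = suc (suc (suc zero)) , root-unique e e′ ν≢ρ
        choose : ∀ ν → (∃ λ k → sp k ≡ ν) ⊎ (∃₂ λ i j → i ≢ j × i ~[ ν ] j)
        choose ν with ν ≟ 0# | ν ≟ 1# | (ν * ν + ν) ≟ 1# | sum? ν
        ... | yes ν≡0 | _ | _ | _ = inj₁ (zero , sym ν≡0)
        ... | no _ | yes ν≡1 | _ | _ = inj₁ (suc zero , sym ν≡1)
        ... | no _ | no _ | yes e | _ = inj₁ (root-special e root?)
        ... | no ν≢0 | no _ | no _ | yes (i , j , e) = inj₂ (i , j , ~-irrefl (ν≢0 , e) , ν≢0 , e)
        ... | no ν≢0 | no ν≢1 | no h | no ¬s = ⊥-elim (none (ν , ν≢0 , ν≢1 , h , ¬s))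

    -- Otherwise every scalar outside four special ones would join two arc points, and
    -- `pairing-bound` would give 2q ≤ 8 + t, against 8 < q and t < q.
    good-scalar : 8 < q → t < q → ∃ λ ν → ν ≢ 0# × ν ≢ 1# × ν * ν + ν ≢ 1# × ¬ IsSum A (ν * y₁) (ν * y₂)
    good-scalar 8<q t<q with any? good?
    ... | yes found = found
    ... | no  none with classify (any? λ ρ → (ρ * ρ + ρ) ≟ 1#) none
    ... | sp , choose = ⊥-elim (ℕₚ.<⇒≱ (ℕₚ.+-mono-< 8<q t<q) (pairing-bound sp _~[_]_ ~-sym ~-unique choose))

  record NormalArc (t : ℕ) : Set where
    field
      arc : AffineArc F t
      η   : K
    open AffineArc arc public
    field
      η≢0          : η ≢ 0#
      η≢1          : η ≢ 1#
      η²+η≢1       : η * η + η ≢ 1#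
      off-parabola : ∀ i → d i ≢ c i * c i
      ≢X           : ∀ i j → c i + c j ≡ 1# → d i + d j ≢ 0#
      ≢Y           : ∀ i j → c i + c j ≡ 0# → d i + d j ≢ 1#
      ≢Z           : ∀ i j → c i + c j ≡ 1# → d i + d j ≢ η

  -- Three scalars make (ν₁,0), (0,ν₂) and ν₃(ν₁,ν₂) non-sums. With η = 1/ν₃, the map (C,D) ↦ (C/ν₁
  -- + D/ν₂, ηD/ν₂) sends them to (1,0), (1,η) and (0,1).
  normal-arc : ∀ {t} → 8 < q → t < q → AffineArc F t → NormalArc t
  normal-arc {t} 8<q t<q A
    with good-scalar A {1#} {0#} (λ e → 0≢1 (sym (proj₁ e))) 8<q t<q | good-scalar A {0#} {1#} (λ e → 0≢1 (sym (proj₂ e))) 8<q t<q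
  ... | ν₁ , ν₁≢0 , _ , _ , ≢₁ | ν₂ , ν₂≢0 , _ , _ , ≢₂
    with good-scalar A {ν₁} {ν₂} (λ e → ν₁≢0 (proj₁ e)) 8<q t<q
  ... | ν₃ , ν₃≢0 , ν₃≢1 , ν₃-root , ≢₃ with inverse ν₁ ν₁≢0 | inverse ν₂ ν₂≢0 | inverse ν₃ ν₃≢0
  -- Shifting the second coordinate by s leaves all sums of two points unchanged; each arc point
  -- forbids one s, the one that would put it on the parabola.
  ... | r₁ , e₁ | r₂ , e₂ | η , e₃ = with-shift (missing-value t<q λ i →
          (r₁ * c i + r₂ * d i) * (r₁ * c i + r₂ * d i) + r₂ * η * d i)
    where
    open AffineArc A
    inverse≢0 : ∀ {x y} → x * y ≡ 1# → y ≢ 0#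
    inverse≢0 {x} h refl = 0≢1 (trans (sym (zeroʳ x)) h)

    with-shift : (∃ λ s → ∀ i → (r₁ * c i + r₂ * d i) * (r₁ * c i + r₂ * d i) + r₂ * η * d i ≢ s) → NormalArc t
    with-shift (s , s-ok) = record
      { arc = transform r₁ r₂ (r₂ * η) s (inverse≢0 e₁) (*-nonzero (inverse≢0 e₂) (inverse≢0 e₃)) A
      ; η = η
      ; η≢0 = inverse≢0 e₃
      ; η≢1 = λ { refl → ν₃≢1 (trans (sym (*-identityʳ ν₃)) e₃) }
      -- The roots of X² + X + 1 are closed under inversion, and η = 1/ν₃.
      ; η²+η≢1 = λ h → ν₃-root (combine₂ (1# + ν₃ * η + ν₃) (ν₃ * ν₃) e₃ h
          (solve 2 (λ ν η → ν :* ν :+ ν :+ 𝟙 := (𝟙 :+ ν :* η :+ ν) :* (ν :* η :+ 𝟙) :+ ν :* ν :* (η :* η :+ η :+ 𝟙)) refl ν₃ η))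
      ; off-parabola = λ i h → s-ok i (combine₁ 1# h
          (solve 3 (λ x y s → x :+ y :+ s := 𝟙 :* (y :+ s :+ x)) refl _ _ s))
      ; ≢X = λ i j h₁ h₂ → ≢₁ (i , j , solve-X (sumᶜ i j) (sumᵈ i j) h₁ h₂)
      ; ≢Y = λ i j h₁ h₂ → ≢₃ (i , j , solve-Y (sumᶜ i j) (sumᵈ i j) h₁ h₂)
      ; ≢Z = λ i j h₁ h₂ → ≢₂ (i , j , solve-Z (sumᶜ i j) (sumᵈ i j) h₁ h₂) }
      where
      sumᶜ : ∀ i j → (r₁ * c i + r₂ * d i) + (r₁ * c j + r₂ * d j) ≡ r₁ * (c i + c j) + r₂ * (d i + d j)
      sumᶜ i j = solve 6 (λ r₁ r₂ cᵢ cⱼ dᵢ dⱼ → (r₁ :* cᵢ :+ r₂ :* dᵢ) :+ (r₁ :* cⱼ :+ r₂ :* dⱼ) :=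
        r₁ :* (cᵢ :+ cⱼ) :+ r₂ :* (dᵢ :+ dⱼ)) refl r₁ r₂ (c i) (c j) (d i) (d j)
      sumᵈ : ∀ i j → (r₂ * η * d i + s) + (r₂ * η * d j + s) ≡ r₂ * η * (d i + d j)
      sumᵈ i j = solve 4 (λ r s dᵢ dⱼ → (r :* dᵢ :+ s) :+ (r :* dⱼ :+ s) := r :* (dᵢ :+ dⱼ)) refl (r₂ * η) s (d i) (d j)

      module _ {C D x y : K} (p : x ≡ r₁ * C + r₂ * D) (p′ : y ≡ r₂ * η * D) where
        D≡ : D ≡ ν₂ * ν₃ * y
        D≡ = combine₃ (D * (ν₃ * η)) D (ν₂ * ν₃) e₂ e₃ p′
          (solve 6 (λ ν₂ r₂ ν₃ η D y → D :+ ν₂ :* ν₃ :* y :=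
            D :* (ν₃ :* η) :* (ν₂ :* r₂ :+ 𝟙) :+ D :* (ν₃ :* η :+ 𝟙) :+ ν₂ :* ν₃ :* (y :+ r₂ :* η :* D)) refl ν₂ r₂ ν₃ η D y)
        C≡ : C ≡ ν₁ * (x + r₂ * D)
        C≡ = combine₂ C ν₁ e₁ p
          (solve 6 (λ ν₁ r₁ r₂ C D x → C :+ ν₁ :* (x :+ r₂ :* D) :=
            C :* (ν₁ :* r₁ :+ 𝟙) :+ ν₁ :* (x :+ (r₁ :* C :+ r₂ :* D))) refl ν₁ r₁ r₂ C D x)

        solve-X : x ≡ 1# → y ≡ 0# → C ≡ ν₁ * 1# × D ≡ ν₁ * 0#
        solve-X refl refl = trans C≡ (trans (cong (λ D → ν₁ * (1# + r₂ * D)) D≡)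
            (solve 4 (λ ν₁ r ν₂ ν₃ → ν₁ :* (𝟙 :+ r :* (ν₂ :* ν₃ :* 𝟘)) := ν₁ :* 𝟙) refl ν₁ r₂ ν₂ ν₃)) ,
          trans D≡ (solve 3 (λ ν₁ ν₂ ν₃ → ν₂ :* ν₃ :* 𝟘 := ν₁ :* 𝟘) refl ν₁ ν₂ ν₃)

        solve-Y : x ≡ 0# → y ≡ 1# → C ≡ ν₃ * ν₁ × D ≡ ν₃ * ν₂
        solve-Y refl refl = trans C≡ (trans (cong (λ D → ν₁ * (0# + r₂ * D)) D≡)
            (combine₁ (ν₁ * ν₃) e₂ (solve 4 (λ ν₁ r ν₂ ν₃ → ν₁ :* (𝟘 :+ r :* (ν₂ :* ν₃ :* 𝟙)) :+ ν₃ :* ν₁ :=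
              ν₁ :* ν₃ :* (ν₂ :* r :+ 𝟙)) refl ν₁ r₂ ν₂ ν₃))) ,
          trans D≡ (solve 2 (λ ν₂ ν₃ → ν₂ :* ν₃ :* 𝟙 := ν₃ :* ν₂) refl ν₂ ν₃)

        solve-Z : x ≡ 1# → y ≡ η → C ≡ ν₂ * 0# × D ≡ ν₂ * 1#
        solve-Z refl refl = trans C≡ (trans (cong (λ D → ν₁ * (1# + r₂ * D)) D≡ν₂)
            (combine₁ ν₁ e₂ (solve 3 (λ ν₁ r ν₂ → ν₁ :* (𝟙 :+ r :* (ν₂ :* 𝟙)) :+ ν₂ :* 𝟘 := ν₁ :* (ν₂ :* r :+ 𝟙)) refl ν₁ r₂ ν₂))) ,
          D≡ν₂
          where
          D≡ν₂ : D ≡ ν₂ * 1#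
          D≡ν₂ = trans D≡ (combine₁ ν₂ e₃ (solve 3 (λ ν₂ ν₃ η → ν₂ :* ν₃ :* η :+ ν₂ :* 𝟙 := ν₂ :* (ν₃ :* η :+ 𝟙)) refl ν₂ ν₃ η))

-- Enumeration of the constructed caps and passage to lists.

towerSize : ℕ → ℕ → ℕ
towerSize q zero    = 2
towerSize q (suc n) = (q ℕ.^ suc n ℕ.∸ 1 ℕ.+ (q ℕ.^ suc n ℕ.∸ 1)) ℕ.+ (q ℕ.^ suc n ℕ.+ towerSize q n)

module Listings {q : ℕ} (F : FieldOn q) (1+1≡0 : FieldOn._⊕_ F (FieldOn.1# F) (FieldOn.1# F) ≡ FieldOn.0# F) (4<q : 4 < q) where
  open Char2 F 1+1≡0
  open Caps F 1+1≡0
  open Coverage F 1+1≡0 4<q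
  open Constructions F 1+1≡0 4<q
  open Complete F 1+1≡0 4<q

  -- Only an upper bound on the length is recorded; repetitions are allowed and are removed in
  -- `complete-cap`.
  record Listing {m} (S : Vec K m → Set) (b : ℕ) : Set where
    field
      list     : List (Vec K m)
      size     : length list ≤ b
      complete : ∀ {v} → S v → v ∈ list
      sound    : ∀ {v} → v ∈ list → S v
  open Listing

  listing-map : ∀ {m n b} {R : Vec K n → Set} (f : Vec K n → Vec K m) → Listing R b → Listing (Image f R) b
  listing-map f l = record
    { list     = List.map f (list l)
    ; size     = ℕₚ.≤-trans (ℕₚ.≤-reflexive (List.length-map f (list l))) (size l)
    ; complete = λ { (image Rx) → ∈-map⁺ f (complete l Rx) }
    ; sound    = λ v∈ → from (∈-map⁻ f v∈) }
    where
    from : ∀ {v} → (∃ λ x → x ∈ list l × v ≡ f x) → Image f _ v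
    from (x , x∈ , refl) = image (sound l x∈)

  listing-∪ : ∀ {m b₁ b₂} {S₁ S₂ : Vec K m → Set} → Listing S₁ b₁ → Listing S₂ b₂ → Listing (λ v → S₁ v ⊎ S₂ v) (b₁ ℕ.+ b₂)
  listing-∪ {S₁ = S₁} {S₂} l₁ l₂ = record
    { list     = list l₁ ++ list l₂
    ; size     = ℕₚ.≤-trans (ℕₚ.≤-reflexive (List.length-++ (list l₁))) (ℕₚ.+-mono-≤ (size l₁) (size l₂))
    ; complete = λ { (inj₁ s) → ∈-++⁺ˡ (complete l₁ s) ; (inj₂ s) → ∈-++⁺ʳ (list l₁) (complete l₂ s) }
    ; sound    = λ v∈ → from (∈-++⁻ (list l₁) v∈) }
    where
    from : ∀ {v} → v ∈ list l₁ ⊎ v ∈ list l₂ → S₁ v ⊎ S₂ v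
    from (inj₁ v∈) = inj₁ (sound l₁ v∈)
    from (inj₂ v∈) = inj₂ (sound l₂ v∈)

  listing-⇔ : ∀ {m b} {S S′ : Vec K m → Set} → (∀ {v} → S v → S′ v) → (∀ {v} → S′ v → S v) → Listing S b → Listing S′ b
  listing-⇔ to from l = record
    { list = list l ; size = size l ; complete = λ s → complete l (from s) ; sound = λ v∈ → to (sound l v∈) }

  listing-⋃ : ∀ {t m b} {S : Fin t → Vec K m → Set} → (∀ i → Listing (S i) b) → Listing (λ v → ∃ λ i → S i v) (t ℕ.* b)
  listing-⋃ {zero} l = record { list = List.[] ; size = z≤n ; complete = λ () ; sound = λ () }
  listing-⋃ {suc t} {S = S} l = listing-⇔ to from (listing-∪ (l zero) (listing-⋃ (λ i → l (suc i))))
    where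
    to : ∀ {v} → S zero v ⊎ (∃ λ i → S (suc i) v) → ∃ λ i → S i v
    to (inj₁ s)       = zero , s
    to (inj₂ (i , s)) = suc i , s
    from : ∀ {v} → (∃ λ i → S i v) → S zero v ⊎ (∃ λ i → S (suc i) v)
    from (zero  , s) = inj₁ s
    from (suc i , s) = inj₂ (i , s)

  listing-layer : ∀ {m b₁ b₂} {C₁ C₂ : Vec K m → Set} → Listing C₁ b₁ → Listing C₂ b₂ → Listing (Layer C₁ C₂) (b₁ ℕ.+ b₂)
  listing-layer l₁ l₂ = listing-⇔
    (λ { (inj₁ (image c)) → affine c ; (inj₂ (image c)) → infinite c })
    (λ { (affine c) → inj₁ (image c) ; (infinite c) → inj₂ (image c) })
    (listing-∪ (listing-map (1# ∷_) l₁) (listing-map (0# ∷_) l₂))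

  listing-pair : ∀ {n b p₁ p₂} {R : Vec K n → Set} → Listing R b → Listing (Pair p₁ p₂ R) (b ℕ.+ b)
  listing-pair {p₁ = p₁} {p₂} l = listing-⇔
    (λ { (inj₁ (image r)) → fst r ; (inj₂ (image r)) → snd r })
    (λ { (fst r) → inj₁ (image r) ; (snd r) → inj₂ (image r) })
    (listing-∪ (listing-map (λ x → p₁ ∷ κ x) l) (listing-map (λ x → p₂ ∷ κ x) l))

  listing-any : ∀ n → Listing (Everything {n}) (q ℕ.^ n)
  listing-any zero = record
    { list = [] List.∷ List.[] ; size = ℕₚ.≤-refl ; complete = λ { {[]} _ → here refl } ; sound = λ _ → tt }
  listing-any (suc n) = listing-⇔ (λ _ → tt) (λ { {h ∷ v} _ → h , image tt })
    (listing-⋃ (λ h → listing-map (h ∷_) (listing-any n)))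

  listing-nonzero : ∀ n → Listing (NonZeroᵛ {n}) (q ℕ.^ n ℕ.∸ 1)
  listing-nonzero n = record
    { list     = filter nonzero? all
    -- The full list contains `𝟎`, which the filter drops, so at least one entry is lost.
    ; size     = ℕₚ.≤-trans (ℕₚ.<⇒≤pred (List.filter-notAll nonzero? all (Any.map (λ e h → h (sym e)) (complete l {𝟎} tt))))
                   (ℕₚ.pred-mono-≤ (size l))
    ; complete = λ v≢𝟎 → ∈-filter⁺ nonzero? (complete l tt) v≢𝟎
    ; sound    = λ v∈ → proj₂ (∈-filter⁻ nonzero? {xs = all} v∈) }
    where
    l = listing-any n
    all = list l
    nonzero? : ∀ v → Dec (v ≢ 𝟎)
    nonzero? v = ¬? (v ≟ᵛ 𝟎)

  module _ {p : K} (p≢0 : p ≢ 0#) (p≢1 : p ≢ 1#) where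

    listing-tower : ∀ n → Listing (Tower p≢0 p≢1 n) (towerSize q n)
    listing-tower zero = record
      { list = (1# ∷ 0# ∷ []) List.∷ (0# ∷ 1# ∷ []) List.∷ List.[]
      ; size = ℕₚ.≤-refl
      ; complete = λ { (affine refl) → here refl ; (infinite (affine {[]} _)) → there (here refl) }
      ; sound = λ { (here refl) → affine refl ; (there (here refl)) → infinite (affine tt) } }
    listing-tower (suc n) = listing-layer (listing-pair (listing-nonzero (suc n)))
      (listing-layer (listing-map κ′ (listing-any (suc n))) (listing-tower n))

    module _ {η : K} (η≢0 : η ≢ 0#) (η≢1 : η ≢ 1#) (n : ℕ) where

      listing-threeCopies : Listing (ThreeCopies p≢0 p≢1 η≢0 η≢1 n)
        ((q ℕ.^ suc n ℕ.+ q ℕ.^ suc n) ℕ.+ (q ℕ.^ suc n ℕ.∸ 1 ℕ.+ towerSize q n))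
      listing-threeCopies = listing-layer (listing-pair (listing-any (suc n)))
        (listing-layer (listing-map κ (listing-nonzero (suc n))) (listing-tower n))

      listing-arcCap : ∀ (η²+η≢1 : η * η + η ≢ 1#) {t} (A : AffineArc F t) →
        Listing (ArcCap p≢0 p≢1 η≢0 η≢1 n η²+η≢1 A)
          ((q ℕ.^ suc (suc n) ℕ.+ q ℕ.^ suc (suc n)) ℕ.+ (t ℕ.* q ℕ.^ suc n ℕ.+
            ((q ℕ.^ suc n ℕ.∸ 1 ℕ.+ (q ℕ.^ suc n ℕ.∸ 1)) ℕ.+ (q ℕ.^ suc n ℕ.∸ 1 ℕ.+ towerSize q n))))
      listing-arcCap h A = listing-layer (listing-pair (listing-any (suc (suc n)))) (listing-layer
        (listing-⇔ (λ { (i , image {x} _) → cone i x }) (λ { (cone i x) → i , image tt })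
          (listing-⋃ (λ i → listing-map (λ x → c i ∷ d i ∷ κ x) (listing-any (suc n)))))
        (listing-layer (listing-pair (listing-nonzero (suc n)))
          (listing-layer (listing-map κ (listing-nonzero (suc n))) (listing-tower n))))
        where open AffineArc A

  private
    lookup-ext : ∀ {m} {u v : Vec K m} → (∀ i → lookup u i ≡ lookup v i) → u ≡ v
    lookup-ext {u = u} {v} h = trans (sym (Vec.tabulate∘lookup u)) (trans (Vec.tabulate-cong h) (Vec.tabulate∘lookup v))

    lookup-comb : ∀ {m} a b (u v : Vec K m) i → lookup (comb a u b v) i ≡ a * lookup u i + b * lookup v i
    lookup-comb a b u v i = Vec.lookup-zipWith _ i u v

    unmap : ∀ {A B : Set} (f : A → B) xs → Fin (length (List.map f xs)) → Fin (length xs)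
    unmap f (x List.∷ xs) zero    = zero
    unmap f (x List.∷ xs) (suc i) = suc (unmap f xs i)

    unmap-injective : ∀ {A B : Set} (f : A → B) xs {i j} → unmap f xs i ≡ unmap f xs j → i ≡ j
    unmap-injective f (x List.∷ xs) {zero}  {zero}  e = refl
    unmap-injective f (x List.∷ xs) {suc i} {suc j} e = cong suc (unmap-injective f xs (suc-injective e))

    lookup-unmap : ∀ {A B : Set} (f : A → B) xs i → List.lookup (List.map f xs) i ≡ f (List.lookup xs (unmap f xs i))
    lookup-unmap f (x List.∷ xs) zero    = refl
    lookup-unmap f (x List.∷ xs) (suc i) = lookup-unmap f xs i

    unique-lookup-injective : ∀ {A : Set} {xs : List A} → Unique xs → ∀ {i j} → List.lookup xs i ≡ List.lookup xs j → i ≡ j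
    unique-lookup-injective (_ ∷ _) {zero} {zero} e = refl
    unique-lookup-injective (x∉ ∷ _) {zero} {suc j} e = ⊥-elim (All.lookup x∉ (∈-lookup j) e)
    unique-lookup-injective (x∉ ∷ _) {suc i} {zero} e = ⊥-elim (All.lookup x∉ (∈-lookup i) (sym e))
    unique-lookup-injective (_ ∷ u) {suc i} {suc j} e = cong suc (unique-lookup-injective u e)

  module _ {m} {S : Vec K (suc m) → Set} (cap : Cap S) where
    open Cap cap

    cap-two : ∀ {u v a b} → S u → S v → u ≢ v → (∀ i → a * lookup u i + b * lookup v i ≡ 0#) → a ≡ 0#
    cap-two {u} {v} {a} {b} Su Sv u≢v h with a ≟ 0#
    ... | yes a≡0 = a≡0
    ... | no  a≢0 with inverse a a≢0
    ... | r , ar≡1 = ⊥-elim (u≢v (sym (distinct Sv Su (lookup-ext λ i → trans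
      (combine₂ (lookup u i) r ar≡1 (h i)
        (solve 5 (λ a b r x y → x :+ r :* b :* y := x :* (a :* r :+ 𝟙) :+ r :* (a :* x :+ b :* y :+ 𝟘))
          refl a b r (lookup u i) (lookup v i)))
      (sym (Vec.lookup-map i (r * b *_) v))))))

    -- A vanishing coefficient leaves a relation between two points, treated by `cap-two`; otherwise
    -- division by c writes `w` as a combination of `u` and `v`.
    cap-three : ∀ {u v w a b c} → S u → S v → S w → u ≢ v → u ≢ w → v ≢ w → ¬ (a ≡ 0# × b ≡ 0# × c ≡ 0#) →
      ¬ (∀ i → a * lookup u i + b * lookup v i + c * lookup w i ≡ 0#)
    cap-three {u} {v} {w} {a} {b} {c} Su Sv Sw u≢v u≢w v≢w nontrivial h with a ≟ 0# | b ≟ 0# | c ≟ 0#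
    ... | yes refl | _ | _ = nontrivial (refl , cap-two Sv Sw v≢w h′ ,
          cap-two Sw Sv (λ e → v≢w (sym e)) (λ i → trans (+-comm _ _) (h′ i)))
      where
      h′ : ∀ i → b * lookup v i + c * lookup w i ≡ 0#
      h′ i = trans (solve 5 (λ b c x y z → b :* y :+ c :* z := 𝟘 :* x :+ b :* y :+ c :* z)
        refl b c (lookup u i) (lookup v i) (lookup w i)) (h i)
    ... | no a≢0 | yes refl | _ = a≢0 (cap-two Su Sw u≢w λ i → trans
      (solve 5 (λ a c x y z → a :* x :+ c :* z := a :* x :+ 𝟘 :* y :+ c :* z)
        refl a c (lookup u i) (lookup v i) (lookup w i)) (h i))
    ... | no a≢0 | no _ | yes refl = a≢0 (cap-two Su Sv u≢v λ i → trans
      (solve 5 (λ a b x y z → a :* x :+ b :* y := a :* x :+ b :* y :+ 𝟘 :* z)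
        refl a b (lookup u i) (lookup v i) (lookup w i)) (h i))
    ... | no a≢0 | no b≢0 | no c≢0 with inverse c c≢0
    ... | r , cr≡1 = independent Su Sv Sw u≢v (*-nonzero r≢0 a≢0) (*-nonzero r≢0 b≢0) (lookup-ext λ i → trans
      (combine₂ (lookup w i) r cr≡1 (h i)
        (solve 7 (λ a b c r x y z → z :+ (r :* a :* x :+ r :* b :* y) :=
          z :* (c :* r :+ 𝟙) :+ r :* (a :* x :+ b :* y :+ c :* z :+ 𝟘))
          refl a b c r (lookup u i) (lookup v i) (lookup w i)))
      (sym (lookup-comb (r * a) (r * b) u v i)))
      where
      r≢0 : r ≢ 0#
      r≢0 refl = 0≢1 (trans (sym (zeroʳ c)) cr≡1)

    -- Once duplicates are removed, distinct indices mean distinct members of `S`. A covered vector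
    -- cannot be added, because it is collinear with two listed points or a multiple of one.
    complete-cap : ∀ {b} → (∀ v → Covered S v) → Listing S b → ∃ λ (L : List (Vect F m)) → IsCompleteCap F L × length L ≤ b
    complete-cap {b} covers l = L , ((nz , same , collinear) , maximal) , length≤
      where
      D : List (Vec K (suc m))
      D = deduplicate _≟ᵛ_ (list l)
      L : List (Vect F m)
      L = List.map lookup D
      D-unique : Unique D
      D-unique = UniqueDec.deduplicate-! _≟ᵛ_ (list l)
      length≤ : length L ≤ b
      length≤ = ℕₚ.≤-trans (ℕₚ.≤-reflexive (List.length-map lookup D))
        (ℕₚ.≤-trans (List.length-deduplicate _≟ᵛ_ (list l)) (size l))

      point : Fin (length L) → Vec K (suc m)
      point i = List.lookup D (unmap lookup D i)
      lookup≡ : ∀ i → List.lookup L i ≡ lookup (point i)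
      lookup≡ = lookup-unmap lookup D
      in-S : ∀ i → S (point i)
      in-S i = sound l (∈-deduplicate⁻ _≟ᵛ_ (list l) (∈-lookup (unmap lookup D i)))
      point≢ : ∀ {i j} → i ≢ j → point i ≢ point j
      point≢ i≢j e = i≢j (unmap-injective lookup D (unique-lookup-injective D-unique e))

      nz : ∀ i → NonZero F (List.lookup L i)
      nz i rewrite lookup≡ i = λ h → nonzero (in-S i) (lookup-ext (λ k → trans (h k) (sym (Vec.lookup-replicate k 0#))))
      same : ∀ i j → ¬ (i ≡ j) → ¬ SamePoint F (List.lookup L i) (List.lookup L j)
      same i j i≢j rewrite lookup≡ i | lookup≡ j = λ { (c , h) → point≢ i≢j (distinct (in-S i) (in-S j)
        (lookup-ext (λ k → trans (h k) (sym (Vec.lookup-map k (c *_) (point i)))))) }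
      collinear : ∀ i j k → ¬ (i ≡ j) → ¬ (i ≡ k) → ¬ (j ≡ k) →
        ¬ Collinear F (List.lookup L i) (List.lookup L j) (List.lookup L k)
      collinear i j k i≢j i≢k j≢k rewrite lookup≡ i | lookup≡ j | lookup≡ k = λ { (a , b , c , nt , h) →
        cap-three (in-S i) (in-S j) (in-S k) (point≢ i≢j) (point≢ i≢k) (point≢ j≢k) nt h }

      index : ∀ {v} → S v → ∃ λ i → List.lookup L i ≡ lookup v
      index s = Any.index v∈ , sym (lookup-index v∈)
        where v∈ = ∈-map⁺ lookup (∈-deduplicate⁺ _≟ᵛ_ (complete l s))

      maximal : ∀ (x : Vect F m) → ¬ IsCap F (x List.∷ L)
      maximal x (_ , no-same , no-collinear) = go (covers (Vec.tabulate x))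
        where
        x≡ : ∀ {a b} {u v : Vec K (suc m)} → Vec.tabulate x ≡ comb a u b v → ∀ k → x k ≡ a * lookup u k + b * lookup v k
        x≡ {a} {b} {u} {v} e k = trans (sym (Vec.lookup∘tabulate x k)) (trans (cong (λ z → lookup z k) e) (lookup-comb a b u v k))
        go : ¬ Covered S (Vec.tabulate x)
        go (u , v , a , b , Su , Sv , e) with index Su | index Sv
        ... | i , i≡ | j , j≡ with i ≟ j
        -- Both ends of the secant are the same listed point, so `x` is a multiple of it.
        ... | yes refl = no-same (suc i) zero (λ ()) (a + b , λ k → trans (x≡ e k) (trans
              (cong₂ (λ f g → a * f k + b * g k) (sym i≡) (sym j≡)) (sym (distribʳ _ a b))))
        ... | no  i≢j  = no-collinear zero (suc i) (suc j) (λ ()) (λ ()) (λ { refl → i≢j refl })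
              (1# , a , b , (λ { (1≡0 , _) → 0≢1 (sym 1≡0) }) , λ k → trans
                (cong₂ (λ f g → 1# * x k + a * f k + b * g k) i≡ j≡)
                (combine₁ 1# (x≡ e k) (solve 3 (λ x p r → 𝟙 :* x :+ p :+ r :+ 𝟘 := 𝟙 :* (x :+ (p :+ r))) refl
                  (x k) (a * lookup u k) (b * lookup v k))))

-- Arithmetic of the bound, and the case distinction on the size of the arc.

open import Data.Nat using (_+_; _*_; _∸_; _^_; _/_; _%_; >-nonZero)
open import Data.Nat.DivMod using (m≡m%n+[m/n]*n; m*n/n≡m)
open import Data.Nat.Properties hiding (_≟_; suc-injective)
open import Data.Nat.Solver using (module +-*-Solver)
open +-*-Solver

dbl≡*2 : ∀ n → dbl n ≡ n * 2
dbl≡*2 zero    = refl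
dbl≡*2 (suc n) = cong (λ m → suc (suc m)) (dbl≡*2 n)

dbl/2 : ∀ n → dbl n / 2 ≡ n
dbl/2 n = trans (cong (_/ 2) (dbl≡*2 n)) (m*n/n≡m n 2)

odd>3 : ∀ N → N % 2 ≡ 1 → 3 < N → ∃ λ n → N ≡ 5 + dbl n
odd>3 N odd 3<N = large (N / 2) (trans (m≡m%n+[m/n]*n N 2) (cong₂ _+_ odd (sym (dbl≡*2 (N / 2)))))
  where
  large : ∀ h → N ≡ 1 + dbl h → ∃ λ n → N ≡ 5 + dbl n
  large zero          refl = ⊥-elim (<⇒≱ 3<N (s≤s z≤n))
  large (suc zero)    refl = ⊥-elim (<⇒≱ 3<N (s≤s (s≤s (s≤s z≤n))))
  large (suc (suc n)) e    = n , e

module _ {q : ℕ} (0<q : 0 < q) where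

  power-pred : ∀ n → q ^ n ≡ suc (q ^ n ∸ 1)
  power-pred n = sym (m+[n∸m]≡n (m^n>0 q {{>-nonZero 0<q}} n))

  -- With Q = qⁿ⁺¹, passing from n to n + 1 adds 2(Q - 1) + Q points, and the growth of `dbl n` by 2
  -- completes this to 3Q. Keeping `dbl n` on the left avoids truncated subtraction.
  towerSize-bound : ∀ n → towerSize q n + dbl n ≤ 3 * sumPow q n + 2
  towerSize-bound zero    = ≤-refl
  towerSize-bound (suc n) = begin
    ((k + k) + (Q + τ)) + (2 + dbl n)     ≡⟨ cong (λ x → ((k + k) + (x + τ)) + (2 + dbl n)) (power-pred (suc n)) ⟩
    ((k + k) + (suc k + τ)) + (2 + dbl n) ≡⟨ solve 3 (λ k τ d → ((k :+ k) :+ ((con 1 :+ k) :+ τ)) :+ (con 2 :+ d) :=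
                                                  con 3 :* (con 1 :+ k) :+ (τ :+ d)) refl k τ (dbl n) ⟩
    3 * suc k + (τ + dbl n)               ≡⟨ cong (λ x → 3 * x + (τ + dbl n)) (power-pred (suc n)) ⟨
    3 * Q + (τ + dbl n)                   ≤⟨ +-monoʳ-≤ (3 * Q) (towerSize-bound n) ⟩
    3 * Q + (3 * sumPow q n + 2)          ≡⟨ solve 2 (λ Q s → con 3 :* Q :+ (con 3 :* s :+ con 2) :=
                                                  con 3 :* (s :+ Q) :+ con 2) refl Q (sumPow q n) ⟩
    3 * (sumPow q n + Q) + 2              ∎
    where
    open ≤-Reasoning
    Q = q ^ suc n
    k = Q ∸ 1
    τ = towerSize q n

  -- The three missing origins and the 2 - 2n of the tower add up to -1 - 2n, which is 4 - N for N =
  -- 5 + 2n.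
  arcCap-bound : ∀ t n → let Q = q ^ suc n ; R = q ^ suc (suc n) in
    (R + R) + (t * Q + ((Q ∸ 1 + (Q ∸ 1)) + (Q ∸ 1 + towerSize q n))) ≤
    (2 * R + (t + 3) * Q + 3 * sumPow q n + 4) ∸ (5 + dbl n)
  arcCap-bound t n = m+n≤o⇒m≤o∸n _ (begin
    ((R + R) + (t * Q + ((k + k) + (k + τ)))) + (5 + dbl n)
      ≡⟨ solve 5 (λ R T k τ d → ((R :+ R) :+ (T :+ ((k :+ k) :+ (k :+ τ)))) :+ (con 5 :+ d) :=
           con 2 :* R :+ (T :+ con 3 :* (con 1 :+ k)) :+ ((τ :+ d) :+ con 2)) refl R (t * Q) k τ (dbl n) ⟩
    2 * R + (t * Q + 3 * suc k) + ((τ + dbl n) + 2)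
      ≡⟨ cong (λ x → 2 * R + (t * Q + 3 * x) + ((τ + dbl n) + 2)) (power-pred (suc n)) ⟨
    2 * R + (t * Q + 3 * Q) + ((τ + dbl n) + 2)
      ≤⟨ +-monoʳ-≤ (2 * R + (t * Q + 3 * Q)) (+-monoˡ-≤ 2 (towerSize-bound n)) ⟩
    2 * R + (t * Q + 3 * Q) + ((3 * sumPow q n + 2) + 2)
      ≡⟨ solve 4 (λ R t Q s → con 2 :* R :+ (t :* Q :+ con 3 :* Q) :+ ((con 3 :* s :+ con 2) :+ con 2) :=
           con 2 :* R :+ (t :+ con 3) :* Q :+ con 3 :* s :+ con 4) refl R t Q (sumPow q n) ⟩
    2 * R + (t + 3) * Q + 3 * sumPow q n + 4 ∎)
    where
    open ≤-Reasoning
    Q = q ^ suc n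
    R = q ^ suc (suc n)
    k = Q ∸ 1
    τ = towerSize q n

  -- Here the third copy is paid for by the arc term, since R = qQ ≤ tQ, and the top step of the
  -- longer tower by 3Q.
  threeCopies-bound : ∀ t n → q ≤ t → let Q = q ^ suc n ; R = q ^ suc (suc n) in
    (R + R) + (R ∸ 1 + towerSize q (suc n)) ≤
    (2 * R + (t + 3) * Q + 3 * sumPow q n + 4) ∸ (5 + dbl n)
  threeCopies-bound t n q≤t = m+n≤o⇒m≤o∸n _ (begin
    ((R + R) + (k + τ)) + (5 + dbl n)
      ≡⟨ solve 4 (λ R k τ d → ((R :+ R) :+ (k :+ τ)) :+ (con 5 :+ d) :=
           con 2 :* R :+ (con 1 :+ k) :+ ((τ :+ (con 2 :+ d)) :+ con 2)) refl R k τ (dbl n) ⟩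
    2 * R + suc k + ((τ + dbl (suc n)) + 2)
      ≡⟨ cong (λ x → 2 * R + x + ((τ + dbl (suc n)) + 2)) (power-pred (suc (suc n))) ⟨
    2 * R + R + ((τ + dbl (suc n)) + 2)
      ≤⟨ +-mono-≤ (+-monoʳ-≤ (2 * R) (*-monoˡ-≤ Q q≤t)) (+-monoˡ-≤ 2 (towerSize-bound (suc n))) ⟩
    2 * R + t * Q + ((3 * (sumPow q n + Q) + 2) + 2)
      ≡⟨ solve 4 (λ R t Q s → con 2 :* R :+ t :* Q :+ ((con 3 :* (s :+ Q) :+ con 2) :+ con 2) :=
           con 2 :* R :+ (t :+ con 3) :* Q :+ con 3 :* s :+ con 4) refl R t Q (sumPow q n) ⟩
    2 * R + (t + 3) * Q + 3 * sumPow q n + 4 ∎)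
    where
    open ≤-Reasoning
    Q = q ^ suc n
    R = q ^ suc (suc n)
    k = R ∸ 1
    τ = towerSize q (suc n)

theorem4p7 : ∀ (N q e : ℕ) → N % 2 ≡ 1 → 3 < N → q ≡ 2 ^ e → 8 < q →
    (F : FieldOn q) → (t : ℕ) → IsT2 F 2 t →
    ∃ λ (L : List (Vect F N)) → IsCompleteCap F L ×
    length L ≤ (2 * q ^ ((N ∸ 1) / 2) + (t + 3) * q ^ ((N ∸ 3) / 2)
    + 3 * sumPow q ((N ∸ 5) / 2) + 4) ∸ N
theorem4p7 N q e N-odd 3<N q≡2^e 8<q F t ((arc , arc-complete , refl) , _)
  with odd>3 N N-odd 3<N
-- For N = 5 + 2n the three halved exponents become n + 2, n + 1 and n.
... | n , refl rewrite dbl/2 n | dbl/2 (suc n) | dbl/2 (suc (suc n)) = cap (length arc <? q)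
  where
  1+1≡0 = characteristic-2 F e q≡2^e
  4<q : 4 < q
  4<q = <-trans (s≤s (s≤s (s≤s (s≤s (s≤s z≤n))))) 8<q
  0<q : 0 < q
  0<q = <-trans (s≤s z≤n) 8<q
  open FieldOn F using (0#; 1#)
  open Coverage F 1+1≡0 4<q
  open Complete F 1+1≡0 4<q
  open Listings F 1+1≡0 4<q
  open Arcs F 1+1≡0
  open NormalForm F 1+1≡0

  Goal = ∃ λ (L : List (Vect F (5 + dbl n))) → IsCompleteCap F L ×
    length L ≤ (2 * q ^ suc (suc n) + (length arc + 3) * q ^ suc n + 3 * sumPow q n + 4) ∸ (5 + dbl n)

  weaken : ∀ {b} → b ≤ (2 * q ^ suc (suc n) + (length arc + 3) * q ^ suc n + 3 * sumPow q n + 4) ∸ (5 + dbl n) →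
    (∃ λ (L : List (Vect F (5 + dbl n))) → IsCompleteCap F L × length L ≤ b) → Goal
  weaken b≤ (L , complete , size) = L , complete , ≤-trans size b≤

  small : ∀ {p} → p ≢ 0# → p ≢ 1# → NormalArc (length arc) → Goal
  small p≢0 p≢1 A = weaken (arcCap-bound 0<q (length arc) n)
    (complete-cap (arcCap-cap p≢0 p≢1 η≢0 η≢1 n η²+η≢1 (NormalArc.arc A) off-parabola ≢X ≢Y ≢Z)
      (arcCap-covers p≢0 p≢1 η≢0 η≢1 n η²+η≢1 (NormalArc.arc A))
      (listing-arcCap p≢0 p≢1 η≢0 η≢1 n η²+η≢1 (NormalArc.arc A)))
    where open NormalArc A hiding (arc)

  large : ∀ {p} → p ≢ 0# → p ≢ 1# → q ≤ length arc → Goal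
  -- One scalar serves both as tower parameter and as η, since each must only differ from 0 and 1.
  -- The index `suc n` brings the vectors to 6 + 2n coordinates.
  large p≢0 p≢1 q≤t = weaken (threeCopies-bound 0<q (length arc) n q≤t)
    (complete-cap (threeCopies-cap p≢0 p≢1 p≢0 p≢1 (suc n)) (threeCopies-covers p≢0 p≢1 p≢0 p≢1 (suc n))
      (listing-threeCopies p≢0 p≢1 p≢0 p≢1 (suc n)))

  cap : Dec (length arc < q) → Goal
  cap small? with avoid-four 0# 1# 0# 1#
  cap (yes t<q) | p , p≢0 , p≢1 , _ = small p≢0 p≢1 (normal-arc 8<q t<q (affine-arc arc-complete t<q))
  cap (no t≮q)  | p , p≢0 , p≢1 , _ = large p≢0 p≢1 (≮⇒≥ t≮q)
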